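{- Consider the equation $a_1x_1^6+\cdots+a_7x_7^6=0$ with $a_1,\dots,a_7\in\mathcal{O}\setminus\{0\}$, and let $k\in\mathbb{Z}/6\mathbb{Z}$. Suppose that there are two variables at level $k$ with the same $\pi$-coefficient, and at least one variable at each of the levels $k+3$ and $k+4$. Then the equation has a nontrivial solution in $K^7$.
   Context: $K$ is one of the fields $\mathbb{Q}_2(\sqrt{ -1})$ or $\mathbb{Q}_2(\sqrt{ -5})$, $\mathcal{O}$ its ring of integers and $\pi$ a fixed uniformizer; the residue field is $\mathbb{F}_2$. Every nonzero $a\in\mathcal{O}$ can be written uniquely as $a=\pi^r(1+c_1\pi+c_2\pi^2+\cdots)$ with $r\ge0$, $c_j\in\{0,1\}$. For $x_i$ with coefficient $a_i=\pi^r(1+c_1\pi+\cdots)$, its level is $r\bmod 6\in\mathbb{Z}/6\mathbb{Z}$ and its $\pi$-coefficient is $c_1$. Levels and expressions such as $k+3$ are read modulo 6 (the paper's convention: $\pi^r u x^6=\pi^{r-6}u(\pi x)^6$, and the equation may be multiplied by $\pi$, neither of which changes $\pi$-coefficients). A nontrivial solution is one with $(x_1,\dots,x_7)\ne0$. -}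

module Defs where

open import Data.Nat as ℕ using (ℕ; zero; suc)
open import Data.Nat.DivMod using (_%_)
open import Data.Integer as ℤ using (ℤ; +_)
open import Data.Integer.Divisibility using (_∣_)
open import Data.Product using (Σ; _×_; _,_; proj₁; proj₂; ∃)
open import Data.Bool using (Bool; true; false)
open import Data.Fin using (Fin; toℕ)
open import Data.List using (List; foldr; map; allFin)
open import Relation.Binary.PropositionalEquality using (_≡_; _≢_)
open import Relation.Nullary using (¬_)

-- The two fields K = Q₂(α), α² = D, with D = -1 or D = -5.
-- In both cases O = Z₂[α] and π = 1 + α is a uniformizer.

data Field : Set where
  Q2i  : Field
  Q2√-5 : Field

D : Field → ℤ
D Q2i   = ℤ.- (+ 1)
D Q2√-5 = ℤ.- (+ 5)

-- Elements a + bα of Z[α], as pairs (a , b).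
Zα : Set
Zα = ℤ × ℤ

module _ (F : Field) where

  infixl 6 _+α_ _-α_
  infixl 7 _*α_

  _+α_ : Zα → Zα → Zα
  (a , b) +α (c , d) = (a ℤ.+ c , b ℤ.+ d)

  _-α_ : Zα → Zα → Zα
  (a , b) -α (c , d) = (a ℤ.- c , b ℤ.- d)

  _*α_ : Zα → Zα → Zα
  (a , b) *α (c , d) = (a ℤ.* c ℤ.+ D F ℤ.* (b ℤ.* d) , a ℤ.* d ℤ.+ b ℤ.* c)

  _^α_ : Zα → ℕ → Zα
  x ^α zero  = (+ 1 , + 0)
  x ^α suc n = x *α (x ^α n)

  sumα : List Zα → Zα
  sumα = foldr _+α_ (+ 0 , + 0)

  πα : Zα
  πα = (+ 1 , + 1)

Cong : ℕ → Zα → Zα → Set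
Cong n (a , b) (c , d) = (+ (2 ℕ.^ n) ∣ (a ℤ.- c)) × (+ (2 ℕ.^ n) ∣ (b ℤ.- d))

-- O = Z₂[α] ≅ Z₂ × Z₂: an element is a coherent sequence of
-- approximations modulo 2ⁿ.

record 𝒪 : Set where
  field
    approx : ℕ → Zα
    coh    : ∀ n → Cong n (approx (suc n)) (approx n)
open 𝒪 public

_≈ₛ_ : (ℕ → Zα) → (ℕ → Zα) → Set
s ≈ₛ t = ∀ n → Cong n (s n) (t n)

zeroα : Zα
zeroα = (+ 0 , + 0)

IsZero : 𝒪 → Set
IsZero x = approx x ≈ₛ (λ _ → zeroα)

Nonzero : 𝒪 → Set
Nonzero x = Σ ℕ λ n → ¬ Cong n (approx x n) zeroα

PiDvd : Field → ℕ → (ℕ → Zα) → Set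
PiDvd F m s = Σ 𝒪 λ y → s ≈ₛ (λ n → _*α_ F (_^α_ F (πα F) m) (approx y n))

digit : Field → Bool → Zα
digit F true  = πα F
digit F false = zeroα

-- a = π^r (1 + c₁π + c₂π² + ⋯): equivalently a ≡ π^r (1 + c₁π) mod π^(r+2).
-- HasExpansionStart F a r c₁ : a has valuation r and π-coefficient c₁.
HasExpansionStart : (F : Field) → 𝒪 → ℕ → Bool → Set
HasExpansionStart F a r c =
  PiDvd F (r ℕ.+ 2)
    (λ n → _-α_ F (approx a n)
                  (_*α_ F (_^α_ F (πα F) r) (_+α_ F (+ 1 , + 0) (digit F c))))

LevelCoef : Field → 𝒪 → ℕ → Bool → Set
LevelCoef F a ℓ c = Σ ℕ λ r → (r % 6 ≡ ℓ % 6) × HasExpansionStart F a r c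

AtLevel : Field → 𝒪 → ℕ → Set
AtLevel F a ℓ = Σ Bool λ c → LevelCoef F a ℓ c

IsSolution : Field → (Fin 7 → 𝒪) → (Fin 7 → 𝒪) → Set
IsSolution F a x =
  (λ n → sumα F (map (λ i → _*α_ F (approx (a i) n) (_^α_ F (approx (x i) n) 6)) (allFin 7)))
    ≈ₛ (λ _ → zeroα)

-- The solution is supported on four variables: x_i = π^e₁ y, x_j = π^e₂, x_p = π^e₃ z and
-- x_q = π^e₄ t with z, t ∈ {0, 1}, the exponents chosen so that the four monomials a x⁶ have
-- valuations M, M, M + 3 and M + 4 (M ≡ k mod 6).  Dividing by π^M, the equation becomes
-- u₁ y⁶ + u₂ + π³ u₃ z + π⁴ u₄ t = 0 with units u₁ ≡ u₂ (mod π²).  Since 8 = π⁶·unit, a solution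
-- modulo 8 is found by a finite computation on residues, and Newton's method lifts it because the
-- derivative 6 u₁ y⁵ has valuation exactly v(2).  That the four indices are distinct, and that
-- x_j ≠ 0, follows from the uniqueness of the valuation, which is read off the 2-adic valuation of
-- the norm N(π^r u) = 2^r · odd.

module Submission where

open import Defs
open import Data.Nat using (ℕ; _+_)
open import Data.Fin using (Fin; toℕ)
open import Data.Bool using (Bool)
open import Data.Product using (Σ; _×_)
open import Relation.Binary.PropositionalEquality using (_≢_)
open import Relation.Nullary using (¬_)

open import Algebra.Bundles using (CommutativeRing)
import Algebra.Properties.CommutativeMonoid.Sum as Sum
import Algebra.Solver.Ring
open import Algebra.Solver.Ring.AlmostCommutativeRing using (fromCommutativeRing; _-Raw-AlmostCommutative⟶_)
open import Algebra.Structures using (IsCommutativeRing)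
open import Data.Bool using (true; false)
open import Data.Empty using (⊥-elim)
open import Data.Fin using (zero; suc; fromℕ<; _≟_)
open import Data.Fin.Patterns using (0F; 1F; 2F; 3F; 4F; 5F)
open import Data.Fin.Properties using (toℕ-fromℕ<; all?; any?)
open import Data.Integer as ℤ using (ℤ; +_; -[1+_])
import Data.Integer.DivMod as ℤ
import Data.Integer.Divisibility.Signed as ℤ
import Data.Integer.Properties as ℤ
open import Data.Integer.Tactic.RingSolver using (solve-∀)
import Data.List as List
import Data.Maybe as Maybe
open import Data.Nat as ℕ using (zero; suc; _≤_; _<_; s≤s; z≤n; NonZero)
import Data.Nat.Divisibility as ℕ
open import Data.Nat.DivMod using (_%_; _/_; m≡m%n+[m/n]*n; [m+kn]%n≡m%n; /-monoˡ-≤)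
import Data.Nat.Properties as ℕ
import Data.Nat.Tactic.RingSolver as ℕ-Solver
open import Data.Product using (_,_; proj₁; proj₂)
open import Data.Sum using (inj₁; inj₂)
open import Data.Vec using (Vec; []; _∷_; lookup)
open import Data.Vec.Functional using (Vector; updateAt; tail)
open import Data.Vec.Functional.Properties using (updateAt-updates; updateAt-minimal)
open import Function using (const; _∘_)
open import Level using (0ℓ)
open import Relation.Binary.Bundles using (Setoid)
open import Relation.Binary.Definitions using (tri<; tri≈; tri>)
open import Relation.Binary.PropositionalEquality
import Relation.Binary.Reasoning.Setoid as SetoidReasoning
open import Relation.Nullary using (Dec; yes; no)
open import Relation.Nullary.Decidable using (toWitness; map′; _×-dec_; _⊎-dec_; dec⇒maybe)

-- The ring operations of ℤ[α] are opaque: the type checker then never unfolds polynomial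
-- expressions into integer arithmetic, which blows up on sixth powers.  For the same reason the
-- witnesses produced by congruent⇒+multiple and seed-root below are opaque.
opaque
  plus times : Field → Zα → Zα → Zα
  plus = _+α_
  times = _*α_

opaque
  negate : Zα → Zα
  negate (a , b) = (ℤ.- a , ℤ.- b)

opaque
  uniformizer : Field → Zα
  uniformizer F = πα F

opaque
  two^ : ℕ → Zα
  two^ n = (+ (2 ℕ.^ n) , + 0)

D≡-1-4t : ∀ F → Σ ℤ λ t → D F ≡ ℤ.- + 1 ℤ.- + 4 ℤ.* t
D≡-1-4t Q2i   = + 0 , refl
D≡-1-4t Q2√-5 = + 1 , refl

π²≡2ρ : ∀ F → Σ Zα λ ρ → _^α_ F (πα F) 2 ≡ _*α_ F (+ 2 , + 0) ρ
π²≡2ρ Q2i   = (+ 0 , + 1) , refl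
π²≡2ρ Q2√-5 = (-[1+ 1 ] , + 1) , refl

Cong? : ∀ n x y → Dec (Cong n x y)
Cong? n (a , b) (c , d) = (2 ℕ.^ n ℕ.∣? ℤ.∣ a ℤ.- c ∣) ×-dec (2 ℕ.^ n ℕ.∣? ℤ.∣ b ℤ.- d ∣)

all-Bool? : ∀ {P : Bool → Set} → (∀ b → Dec (P b)) → Dec (∀ b → P b)
all-Bool? P? = map′ (λ (p , q) → λ { true → p ; false → q }) (λ p → p true , p false) (P? true ×-dec P? false)

any-Bool? : ∀ {P : Bool → Set} → (∀ b → Dec (P b)) → Dec (Σ Bool P)
any-Bool? P? = map′ (λ { (inj₁ p) → true , p ; (inj₂ q) → false , q })(λ { (true , p) → inj₁ p ; (false , p) → inj₂ p })
                    (P? true ⊎-dec P? false)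

-- Units y₀ together with γ = (y₀⁶ + 1)/π² modulo 4; the four values of γ are enough for
-- the residue check below.
seeds γs : Field → Vec Zα 4
seeds Q2i   = (+ 1 , + 0) ∷ (+ 2 , + 1) ∷ (+ 1 , + 2) ∷ (+ 0 , + 1) ∷ []
seeds Q2√-5 = (+ 1 , + 0) ∷ (+ 0 , + 1) ∷ (+ 1 , + 2) ∷ (+ 2 , + 1) ∷ []
γs Q2i      = (+ 0 , + 3) ∷ (+ 2 , + 2) ∷ (+ 2 , + 1) ∷ (+ 0 , + 0) ∷ []
γs Q2√-5    = (+ 2 , + 3) ∷ (+ 0 , + 2) ∷ (+ 0 , + 1) ∷ (+ 2 , + 0) ∷ []

opaque
  congruent⇒+multiple : ∀ d .{{_ : NonZero d}} r T → r % d ≡ T % d → r ≤ T → Σ ℕ λ e → r ℕ.+ e ℕ.* d ≡ T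
  congruent⇒+multiple d r T r≡T r≤T = T / d ℕ.∸ r / d , (begin
    r ℕ.+ (T / d ℕ.∸ r / d) ℕ.* d                       ≡⟨ cong (ℕ._+ (T / d ℕ.∸ r / d) ℕ.* d) (m≡m%n+[m/n]*n r d) ⟩
    r % d ℕ.+ r / d ℕ.* d ℕ.+ (T / d ℕ.∸ r / d) ℕ.* d   ≡⟨ ℕ.+-assoc (r % d) _ _ ⟩
    r % d ℕ.+ (r / d ℕ.* d ℕ.+ (T / d ℕ.∸ r / d) ℕ.* d) ≡⟨ cong (r % d ℕ.+_) (ℕ.*-distribʳ-+ d (r / d) _) ⟨
    r % d ℕ.+ (r / d ℕ.+ (T / d ℕ.∸ r / d)) ℕ.* d       ≡⟨ cong₂ (λ m q → m ℕ.+ q ℕ.* d) r≡T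
                                                                    (ℕ.m+[n∸m]≡n (/-monoˡ-≤ d r≤T)) ⟩
    T % d ℕ.+ T / d ℕ.* d                               ≡⟨ m≡m%n+[m/n]*n T d ⟨
    T                                                   ∎)
    where open ≡-Reasoning

levels-distinct : ∀ (k : Fin 6) → let ℓ = toℕ k in
  ℓ % 6 ≢ (ℓ ℕ.+ 3) % 6 × ℓ % 6 ≢ (ℓ ℕ.+ 4) % 6 × (ℓ ℕ.+ 3) % 6 ≢ (ℓ ℕ.+ 4) % 6
levels-distinct 0F = (λ ()) , (λ ()) , (λ ())
levels-distinct 1F = (λ ()) , (λ ()) , (λ ())
levels-distinct 2F = (λ ()) , (λ ()) , (λ ())
levels-distinct 3F = (λ ()) , (λ ()) , (λ ())
levels-distinct 4F = (λ ()) , (λ ()) , (λ ())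
levels-distinct 5F = (λ ()) , (λ ()) , (λ ())

module SexticForms (F : Field) where

  infixl 6 _⊕_ _⊖_
  infixl 7 _⊛_
  infixr 8 _^_
  infix 8 -_

  _⊕_ _⊛_ : Zα → Zα → Zα
  _⊕_ = plus F
  _⊛_ = times F

  -_ : Zα → Zα
  -_ = negate

  _⊖_ : Zα → Zα → Zα
  x ⊖ y = x ⊕ - y

  𝟘 𝟙 : Zα
  𝟘 = zeroα
  𝟙 = (+ 1 , + 0)

  _^_ : Zα → ℕ → Zα
  x ^ zero  = 𝟙
  x ^ suc n = x ⊛ x ^ n

  π : Zα
  π = uniformizer F

  opaque
    unfolding uniformizer
    π≡πα : π ≡ πα F
    π≡πα = refl

  ι : ℤ → Zα
  ι a = (a , + 0)

  opaque
    unfolding plus times negate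
    ⊛-assoc : ∀ x y z → (x ⊛ y) ⊛ z ≡ x ⊛ (y ⊛ z)
    ⊛-assoc (a , b) (c , d) (e , f) = cong₂ _,_ (re (D F) a b c d e f) (im (D F) a b c d e f)
      where
      re : ∀ δ a b c d e f → (a ℤ.* c ℤ.+ δ ℤ.* (b ℤ.* d)) ℤ.* e ℤ.+ δ ℤ.* ((a ℤ.* d ℤ.+ b ℤ.* c) ℤ.* f)
                           ≡ a ℤ.* (c ℤ.* e ℤ.+ δ ℤ.* (d ℤ.* f)) ℤ.+ δ ℤ.* (b ℤ.* (c ℤ.* f ℤ.+ d ℤ.* e))
      re = solve-∀
      im : ∀ δ a b c d e f → (a ℤ.* c ℤ.+ δ ℤ.* (b ℤ.* d)) ℤ.* f ℤ.+ (a ℤ.* d ℤ.+ b ℤ.* c) ℤ.* e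
                           ≡ a ℤ.* (c ℤ.* f ℤ.+ d ℤ.* e) ℤ.+ b ℤ.* (c ℤ.* e ℤ.+ δ ℤ.* (d ℤ.* f))
      im = solve-∀

    ⊛-comm : ∀ x y → x ⊛ y ≡ y ⊛ x
    ⊛-comm (a , b) (c , d) = cong₂ _,_ (re (D F) a b c d) (im a b c d)
      where
      re : ∀ δ a b c d → a ℤ.* c ℤ.+ δ ℤ.* (b ℤ.* d) ≡ c ℤ.* a ℤ.+ δ ℤ.* (d ℤ.* b)
      re = solve-∀
      im : ∀ a b c d → a ℤ.* d ℤ.+ b ℤ.* c ≡ c ℤ.* b ℤ.+ d ℤ.* a
      im = solve-∀

    ⊛-identityˡ : ∀ x → 𝟙 ⊛ x ≡ x
    ⊛-identityˡ (a , b) = cong₂ _,_ (re (D F) a b) (im a b)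
      where
      re : ∀ δ a b → + 1 ℤ.* a ℤ.+ δ ℤ.* (+ 0 ℤ.* b) ≡ a
      re = solve-∀
      im : ∀ a b → + 1 ℤ.* b ℤ.+ + 0 ℤ.* a ≡ b
      im = solve-∀

    ⊛-distribˡ-⊕ : ∀ x y z → x ⊛ (y ⊕ z) ≡ x ⊛ y ⊕ x ⊛ z
    ⊛-distribˡ-⊕ (a , b) (c , d) (e , f) = cong₂ _,_ (re (D F) a b c d e f) (im a b c d e f)
      where
      re : ∀ δ a b c d e f → a ℤ.* (c ℤ.+ e) ℤ.+ δ ℤ.* (b ℤ.* (d ℤ.+ f))
                           ≡ (a ℤ.* c ℤ.+ δ ℤ.* (b ℤ.* d)) ℤ.+ (a ℤ.* e ℤ.+ δ ℤ.* (b ℤ.* f))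
      re = solve-∀
      im : ∀ a b c d e f → a ℤ.* (d ℤ.+ f) ℤ.+ b ℤ.* (c ℤ.+ e) ≡ (a ℤ.* d ℤ.+ b ℤ.* c) ℤ.+ (a ℤ.* f ℤ.+ b ℤ.* e)
      im = solve-∀

    isCommutativeRing : IsCommutativeRing _≡_ _⊕_ _⊛_ -_ 𝟘 𝟙
    isCommutativeRing = record
      { isRing = record
        { +-isAbelianGroup = record
          { isGroup = record
            { isMonoid = record
              { isSemigroup = record
                { isMagma = record { isEquivalence = isEquivalence ; ∙-cong = cong₂ _⊕_ }
                ; assoc = λ (a , b) (c , d) (e , f) → cong₂ _,_ (ℤ.+-assoc a c e) (ℤ.+-assoc b d f) }
              ; identity = (λ (a , b) → cong₂ _,_ (ℤ.+-identityˡ a) (ℤ.+-identityˡ b))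
                         , (λ (a , b) → cong₂ _,_ (ℤ.+-identityʳ a) (ℤ.+-identityʳ b)) }
            ; inverse = (λ (a , b) → cong₂ _,_ (ℤ.+-inverseˡ a) (ℤ.+-inverseˡ b))
                      , (λ (a , b) → cong₂ _,_ (ℤ.+-inverseʳ a) (ℤ.+-inverseʳ b))
            ; ⁻¹-cong = cong -_ }
          ; comm = λ (a , b) (c , d) → cong₂ _,_ (ℤ.+-comm a c) (ℤ.+-comm b d) }
        ; *-cong = cong₂ _⊛_
        ; *-assoc = ⊛-assoc
        ; *-identity = ⊛-identityˡ , λ x → trans (⊛-comm x 𝟙) (⊛-identityˡ x)
        ; distrib = ⊛-distribˡ-⊕
                  , λ x y z → trans (⊛-comm (y ⊕ z) x)
                                    (trans (⊛-distribˡ-⊕ x y z) (cong₂ _⊕_ (⊛-comm x y) (⊛-comm x z))) }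
      ; *-comm = ⊛-comm }

  commutativeRing : CommutativeRing 0ℓ 0ℓ
  commutativeRing = record { isCommutativeRing = isCommutativeRing }

  open CommutativeRing commutativeRing public
    using () renaming (*-identityʳ to ⊛-identityʳ; +-identityʳ to ⊕-identityʳ; zeroˡ to ⊛-zeroˡ; zeroʳ to ⊛-zeroʳ)

  opaque
    unfolding plus times negate

    ι-⊕ : ∀ a b → ι (a ℤ.+ b) ≡ ι a ⊕ ι b
    ι-⊕ a b = refl

    ι-neg : ∀ a → ι (ℤ.- a) ≡ - ι a
    ι-neg a = refl

    ι-⊛ : ∀ a b → ι (a ℤ.* b) ≡ ι a ⊛ ι b
    ι-⊛ a b = cong₂ _,_ (re (D F) a b) (im a b)
      where
      re : ∀ δ a b → a ℤ.* b ≡ a ℤ.* b ℤ.+ δ ℤ.* (+ 0 ℤ.* + 0)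
      re = solve-∀
      im : ∀ a b → + 0 ≡ a ℤ.* + 0 ℤ.+ + 0 ℤ.* b
      im = solve-∀

    ⊕≡+α : ∀ x y → x ⊕ y ≡ _+α_ F x y
    ⊕≡+α x y = refl

    ⊛≡*α : ∀ x y → x ⊛ y ≡ _*α_ F x y
    ⊛≡*α x y = refl

    ⊖≡-α : ∀ x y → x ⊖ y ≡ _-α_ F x y
    ⊖≡-α x y = refl

  ^≡^α : ∀ x n → x ^ n ≡ _^α_ F x n
  ^≡^α x zero    = refl
  ^≡^α x (suc n) = trans (⊛≡*α x (x ^ n)) (cong (_*α_ F x) (^≡^α x n))

  ι-homomorphism : CommutativeRing.rawRing ℤ.+-*-commutativeRing -Raw-AlmostCommutative⟶ fromCommutativeRing commutativeRing
  ι-homomorphism = record { ⟦_⟧ = ι ; +-homo = ι-⊕ ; -‿homo = ι-neg ; *-homo = ι-⊛ ; 0-homo = refl ; 1-homo = refl }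

  module RingSolver = Algebra.Solver.Ring
    (CommutativeRing.rawRing ℤ.+-*-commutativeRing) (fromCommutativeRing commutativeRing) ι-homomorphism
    (λ a b → Maybe.map (cong ι) (dec⇒maybe (a ℤ.≟ b)))
  open RingSolver public using (solve; _:=_; _:+_; _:-_; _:*_; :-_; _:^_; con)

  ^-+ : ∀ x m n → x ^ (m ℕ.+ n) ≡ x ^ m ⊛ x ^ n
  ^-+ x zero    n = sym (⊛-identityˡ (x ^ n))
  ^-+ x (suc m) n = trans (cong (x ⊛_) (^-+ x m n)) (sym (⊛-assoc x (x ^ m) (x ^ n)))

  ^-* : ∀ x m n → (x ^ m) ^ n ≡ x ^ (m ℕ.* n)
  ^-* x m zero    = cong (x ^_) (sym (ℕ.*-zeroʳ m))
  ^-* x m (suc n) = begin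
    x ^ m ⊛ (x ^ m) ^ n    ≡⟨ cong (x ^ m ⊛_) (^-* x m n) ⟩
    x ^ m ⊛ x ^ (m ℕ.* n)  ≡⟨ ^-+ x m (m ℕ.* n) ⟨
    x ^ (m ℕ.+ m ℕ.* n)    ≡⟨ cong (x ^_) (ℕ.*-suc m n) ⟨
    x ^ (m ℕ.* suc n)      ∎
    where open ≡-Reasoning

  𝟙^ : ∀ n → 𝟙 ^ n ≡ 𝟙
  𝟙^ zero    = refl
  𝟙^ (suc n) = trans (⊛-identityˡ (𝟙 ^ n)) (𝟙^ n)

  𝟘^suc : ∀ n → 𝟘 ^ suc n ≡ 𝟘
  𝟘^suc n = ⊛-zeroˡ (𝟘 ^ n)

  ⊛-^ : ∀ x y n → (x ⊛ y) ^ n ≡ x ^ n ⊛ y ^ n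
  ⊛-^ x y zero    = sym (⊛-identityˡ 𝟙)
  ⊛-^ x y (suc n) = trans (cong ((x ⊛ y) ⊛_) (⊛-^ x y n)) (swap x y (x ^ n) (y ^ n))
    where
    swap : ∀ a b c d → (a ⊛ b) ⊛ (c ⊛ d) ≡ (a ⊛ c) ⊛ (b ⊛ d)
    swap = solve 4 (λ a b c d → (a :* b) :* (c :* d) := (a :* c) :* (b :* d)) refl

  -- Congruences modulo powers of 2

  opaque
    unfolding two^
    two^≡ : ∀ n → two^ n ≡ ι (+ (2 ℕ.^ n))
    two^≡ n = refl

  two^-+ : ∀ m n → two^ (m ℕ.+ n) ≡ two^ m ⊛ two^ n
  two^-+ m n = begin
    two^ (m ℕ.+ n)                          ≡⟨ two^≡ (m ℕ.+ n) ⟩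
    ι (+ (2 ℕ.^ (m ℕ.+ n)))                 ≡⟨ cong (λ k → ι (+ k)) (ℕ.^-distribˡ-+-* 2 m n) ⟩
    ι (+ (2 ℕ.^ m ℕ.* 2 ℕ.^ n))             ≡⟨ cong ι (ℤ.pos-* (2 ℕ.^ m) (2 ℕ.^ n)) ⟩
    ι (+ (2 ℕ.^ m) ℤ.* + (2 ℕ.^ n))         ≡⟨ ι-⊛ (+ (2 ℕ.^ m)) (+ (2 ℕ.^ n)) ⟩
    ι (+ (2 ℕ.^ m)) ⊛ ι (+ (2 ℕ.^ n))       ≡⟨ cong₂ _⊛_ (two^≡ m) (two^≡ n) ⟨
    two^ m ⊛ two^ n                          ∎
    where open ≡-Reasoning

  infix 4 2^_∣_ _≈[_]_

  record 2^_∣_ (n : ℕ) (x : Zα) : Set where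
    constructor divides
    field
      quotient : Zα
      equality : x ≡ two^ n ⊛ quotient
  open 2^_∣_ public

  ∣-resp : ∀ {n x y} → x ≡ y → 2^ n ∣ x → 2^ n ∣ y
  ∣-resp refl d = d

  ∣𝟘 : ∀ {n} → 2^ n ∣ 𝟘
  ∣𝟘 {n} = divides 𝟘 (solve 1 (λ c → con (+ 0) := c :* con (+ 0)) refl (two^ n))

  ∣-⊕ : ∀ {n x y} → 2^ n ∣ x → 2^ n ∣ y → 2^ n ∣ x ⊕ y
  ∣-⊕ {n} (divides q refl) (divides r refl) =
    divides (q ⊕ r) (solve 3 (λ c q r → c :* q :+ c :* r := c :* (q :+ r)) refl (two^ n) q r)

  ∣-neg : ∀ {n x} → 2^ n ∣ x → 2^ n ∣ - x
  ∣-neg {n} (divides q refl) = divides (- q) (solve 2 (λ c q → :- (c :* q) := c :* (:- q)) refl (two^ n) q)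

  ∣-⊛ˡ : ∀ {n x} y → 2^ n ∣ x → 2^ n ∣ y ⊛ x
  ∣-⊛ˡ {n} y (divides q refl) =
    divides (y ⊛ q) (solve 3 (λ c q y → y :* (c :* q) := c :* (y :* q)) refl (two^ n) q y)

  ∣-⊛ʳ : ∀ {n x} y → 2^ n ∣ x → 2^ n ∣ x ⊛ y
  ∣-⊛ʳ {n} y (divides q refl) = divides (q ⊛ y) (⊛-assoc (two^ n) q y)

  ∣-⊛ : ∀ {m n x y} → 2^ m ∣ x → 2^ n ∣ y → 2^ (m ℕ.+ n) ∣ x ⊛ y
  ∣-⊛ {m} {n} (divides q refl) (divides r refl) = divides (q ⊛ r) (begin
    (two^ m ⊛ q) ⊛ (two^ n ⊛ r)   ≡⟨ solve 4 (λ a q b r → (a :* q) :* (b :* r) := (a :* b) :* (q :* r)) refl (two^ m) q (two^ n) r ⟩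
    (two^ m ⊛ two^ n) ⊛ (q ⊛ r)   ≡⟨ cong (_⊛ (q ⊛ r)) (two^-+ m n) ⟨
    two^ (m ℕ.+ n) ⊛ (q ⊛ r)      ∎)
    where open ≡-Reasoning

  ∣-two^⊛ : ∀ n x → 2^ n ∣ two^ n ⊛ x
  ∣-two^⊛ n x = divides x refl

  ∣-weaken : ∀ {m n x} → m ≤ n → 2^ n ∣ x → 2^ m ∣ x
  ∣-weaken {m} m≤n (divides q refl) with ℕ.m≤n⇒∃[o]m+o≡n m≤n
  ... | o , refl = divides (two^ o ⊛ q) (trans (cong (_⊛ q) (two^-+ m o)) (⊛-assoc (two^ m) (two^ o) q))

  record _≈[_]_ (x : Zα) (n : ℕ) (y : Zα) : Set where
    constructor mk≈
    field
      divides-difference : 2^ n ∣ x ⊖ y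
  open _≈[_]_ public

  ∣⇒≈𝟘 : ∀ {n x} → 2^ n ∣ x → x ≈[ n ] 𝟘
  ∣⇒≈𝟘 {x = x} d = mk≈ (∣-resp (solve 1 (λ x → x := x :- con (+ 0)) refl x) d)

  ≈𝟘⇒∣ : ∀ {n x} → x ≈[ n ] 𝟘 → 2^ n ∣ x
  ≈𝟘⇒∣ {x = x} (mk≈ d) = ∣-resp (solve 1 (λ x → x :- con (+ 0) := x) refl x) d

  ≈-refl : ∀ {n x} → x ≈[ n ] x
  ≈-refl {x = x} = mk≈ (∣-resp (solve 1 (λ x → con (+ 0) := x :- x) refl x) ∣𝟘)

  ≈-reflexive : ∀ {n x y} → x ≡ y → x ≈[ n ] y
  ≈-reflexive refl = ≈-refl

  ≈-sym : ∀ {n x y} → x ≈[ n ] y → y ≈[ n ] x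
  ≈-sym {x = x} {y} (mk≈ d) = mk≈ (∣-resp (solve 2 (λ x y → :- (x :- y) := y :- x) refl x y) (∣-neg d))

  ≈-trans : ∀ {n x y z} → x ≈[ n ] y → y ≈[ n ] z → x ≈[ n ] z
  ≈-trans {x = x} {y} {z} (mk≈ d) (mk≈ e) =
    mk≈ (∣-resp (solve 3 (λ x y z → (x :- y) :+ (y :- z) := x :- z) refl x y z) (∣-⊕ d e))

  ≈-setoid : ℕ → Setoid 0ℓ 0ℓ
  ≈-setoid n = record
    { Carrier = Zα
    ; _≈_ = _≈[ n ]_
    ; isEquivalence = record { refl = ≈-refl ; sym = ≈-sym ; trans = ≈-trans } }

  ⊕-cong : ∀ {n x x′ y y′} → x ≈[ n ] x′ → y ≈[ n ] y′ → x ⊕ y ≈[ n ] x′ ⊕ y′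
  ⊕-cong {x = x} {x′} {y} {y′} (mk≈ d) (mk≈ e) = mk≈ (∣-resp
    (solve 4 (λ x x′ y y′ → (x :- x′) :+ (y :- y′) := (x :+ y) :- (x′ :+ y′)) refl x x′ y y′) (∣-⊕ d e))

  neg-cong : ∀ {n x x′} → x ≈[ n ] x′ → - x ≈[ n ] - x′
  neg-cong {x = x} {x′} (mk≈ d) =
    mk≈ (∣-resp (solve 2 (λ x x′ → :- (x :- x′) := (:- x) :- (:- x′)) refl x x′) (∣-neg d))

  ⊛-cong : ∀ {n x x′ y y′} → x ≈[ n ] x′ → y ≈[ n ] y′ → x ⊛ y ≈[ n ] x′ ⊛ y′
  ⊛-cong {x = x} {x′} {y} {y′} (mk≈ d) (mk≈ e) = mk≈ (∣-resp
    (solve 4 (λ x x′ y y′ → (x :- x′) :* y :+ x′ :* (y :- y′) := x :* y :- x′ :* y′) refl x x′ y y′)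
    (∣-⊕ (∣-⊛ʳ y d) (∣-⊛ˡ x′ e)))

  ^-cong : ∀ {n x x′} k → x ≈[ n ] x′ → x ^ k ≈[ n ] x′ ^ k
  ^-cong zero    _ = ≈-refl
  ^-cong (suc k) e = ⊛-cong e (^-cong k e)

  ≈-weaken : ∀ {m n x y} → m ≤ n → x ≈[ n ] y → x ≈[ m ] y
  ≈-weaken m≤n (mk≈ d) = mk≈ (∣-weaken m≤n d)

  ≈-∣ : ∀ {n x y} → x ≈[ n ] y → 2^ n ∣ y → 2^ n ∣ x
  ≈-∣ {x = x} {y} (mk≈ d) e = ∣-resp (solve 2 (λ x y → (x :- y) :+ y := x) refl x y) (∣-⊕ d e)

  opaque
    unfolding plus times negate two^
    Cong⇒≈ : ∀ {n x y} → Cong n x y → x ≈[ n ] y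
    Cong⇒≈ {n} (d₁ , d₂) with ℤ.∣ᵤ⇒∣ d₁ | ℤ.∣ᵤ⇒∣ d₂
    ... | ℤ.divides q₁ e₁ | ℤ.divides q₂ e₂ =
      mk≈ (divides (q₁ , q₂) (trans (cong₂ _,_ (trans e₁ (re (+ (2 ℕ.^ n)) q₁ q₂ (D F))) (trans e₂ (im (+ (2 ℕ.^ n)) q₁ q₂)))
                                    (cong (_⊛ (q₁ , q₂)) (sym (two^≡ n)))))
      where
      re : ∀ c q₁ q₂ δ → q₁ ℤ.* c ≡ c ℤ.* q₁ ℤ.+ δ ℤ.* (+ 0 ℤ.* q₂)
      re = solve-∀
      im : ∀ c q₁ q₂ → q₂ ℤ.* c ≡ c ℤ.* q₂ ℤ.+ + 0 ℤ.* q₁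
      im = solve-∀

    ≈⇒Cong : ∀ {n x y} → x ≈[ n ] y → Cong n x y
    ≈⇒Cong {n} (mk≈ (divides (q₁ , q₂) e)) =
      ℤ.∣⇒∣ᵤ (ℤ.divides q₁ (trans (cong proj₁ e) (sym (re (+ (2 ℕ.^ n)) q₁ q₂ (D F))))) ,
      ℤ.∣⇒∣ᵤ (ℤ.divides q₂ (trans (cong proj₂ e) (sym (im (+ (2 ℕ.^ n)) q₁ q₂))))
      where
      re : ∀ c q₁ q₂ δ → q₁ ℤ.* c ≡ c ℤ.* q₁ ℤ.+ δ ℤ.* (+ 0 ℤ.* q₂)
      re = solve-∀
      im : ∀ c q₁ q₂ → q₂ ℤ.* c ≡ c ℤ.* q₂ ℤ.+ + 0 ℤ.* q₁
      im = solve-∀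

  residueℤ : ∀ m z → Σ (Fin (2 ℕ.^ m)) λ r → + (2 ℕ.^ m) ℤ.∣ z ℤ.- + toℕ r
  residueℤ m z = fromℕ< (ℤ.n%ℕd<d z d) , ℤ.divides (z ℤ./ℕ d) (begin
    z ℤ.- + toℕ (fromℕ< (ℤ.n%ℕd<d z d))  ≡⟨ cong (λ r → z ℤ.- + r) (toℕ-fromℕ< (ℤ.n%ℕd<d z d)) ⟩
    z ℤ.- + (z ℤ.%ℕ d)                    ≡⟨ cong (ℤ._- + (z ℤ.%ℕ d)) (ℤ.a≡a%ℕn+[a/ℕn]*n z d) ⟩
    + (z ℤ.%ℕ d) ℤ.+ (z ℤ./ℕ d) ℤ.* + d ℤ.- + (z ℤ.%ℕ d)  ≡⟨ cancel (+ (z ℤ.%ℕ d)) ((z ℤ./ℕ d) ℤ.* + d) ⟩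
    (z ℤ./ℕ d) ℤ.* + d                    ∎)
    where
    open ≡-Reasoning
    d = 2 ℕ.^ m
    instance _ = ℕ.m^n≢0 2 m
    cancel : ∀ r s → r ℤ.+ s ℤ.- r ≡ s
    cancel = solve-∀

  residue : ∀ m x → Σ (Fin (2 ℕ.^ m)) λ a → Σ (Fin (2 ℕ.^ m)) λ b → x ≈[ m ] (+ toℕ a , + toℕ b)
  residue m (x₁ , x₂) with residueℤ m x₁ | residueℤ m x₂
  ... | a , d₁ | b , d₂ = a , b , Cong⇒≈ (ℤ.∣⇒∣ᵤ d₁ , ℤ.∣⇒∣ᵤ d₂)

  -- Modulo 2 the units of ℤ[α] are exactly the square roots of 1.
  record Unit (u : Zα) : Set where
    constructor unit
    field
      square≈𝟙 : u ⊛ u ≈[ 1 ] 𝟙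
  open Unit public

  coherent-+ : (T : ℕ → Zα) → (∀ n → T (suc n) ≈[ n ] T n) → ∀ k n → T (k ℕ.+ n) ≈[ n ] T n
  coherent-+ T coherent zero    n = ≈-refl
  coherent-+ T coherent (suc k) n = ≈-trans (≈-weaken (ℕ.m≤n+m n k) (coherent (k ℕ.+ n))) (coherent-+ T coherent k n)

  -- The norm and the valuation

  N : Zα → ℤ
  N (a , b) = a ℤ.* a ℤ.- D F ℤ.* (b ℤ.* b)

  opaque
    unfolding plus times negate two^
    N-⊛ : ∀ x y → N (x ⊛ y) ≡ N x ℤ.* N y
    N-⊛ (a , b) (c , d) = brahmagupta (D F) a b c d
      where
      brahmagupta : ∀ δ a b c d →
        (a ℤ.* c ℤ.+ δ ℤ.* (b ℤ.* d)) ℤ.* (a ℤ.* c ℤ.+ δ ℤ.* (b ℤ.* d))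
          ℤ.- δ ℤ.* ((a ℤ.* d ℤ.+ b ℤ.* c) ℤ.* (a ℤ.* d ℤ.+ b ℤ.* c))
        ≡ (a ℤ.* a ℤ.- δ ℤ.* (b ℤ.* b)) ℤ.* (c ℤ.* c ℤ.- δ ℤ.* (d ℤ.* d))
      brahmagupta = solve-∀

    N-cong : ∀ {n x y} → x ≈[ n ] y → + (2 ℕ.^ n) ℤ.∣ N x ℤ.- N y
    N-cong {n} {x} {y} (mk≈ (divides q e)) = ℤ.divides (quotient′ (D F) (+ (2 ℕ.^ n)) y q) (begin
      N x ℤ.- N y                    ≡⟨ cong (λ x → N x ℤ.- N y) x≡y+2ⁿq ⟩
      N (y ⊕ two^ n ⊛ q) ℤ.- N y     ≡⟨ cong (λ T → N (y ⊕ T ⊛ q) ℤ.- N y) (two^≡ n) ⟩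
      N (y ⊕ ι (+ (2 ℕ.^ n)) ⊛ q) ℤ.- N y  ≡⟨ expand (D F) (+ (2 ℕ.^ n)) (proj₁ y) (proj₂ y) (proj₁ q) (proj₂ q) ⟩
      quotient′ (D F) (+ (2 ℕ.^ n)) y q ℤ.* + (2 ℕ.^ n)  ∎)
      where
      open ≡-Reasoning
      quotient′ : ℤ → ℤ → Zα → Zα → ℤ
      quotient′ δ c (y₁ , y₂) (q₁ , q₂) =
        + 2 ℤ.* y₁ ℤ.* q₁ ℤ.+ c ℤ.* q₁ ℤ.* q₁ ℤ.- δ ℤ.* (+ 2 ℤ.* y₂ ℤ.* q₂ ℤ.+ c ℤ.* q₂ ℤ.* q₂)
      x≡y+2ⁿq : x ≡ y ⊕ two^ n ⊛ q
      x≡y+2ⁿq = trans (solve 2 (λ x y → x := y :+ (x :- y)) refl x y) (cong (y ⊕_) e)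
      expand : ∀ δ c y₁ y₂ q₁ q₂ →
        (y₁ ℤ.+ (c ℤ.* q₁ ℤ.+ δ ℤ.* (+ 0 ℤ.* q₂))) ℤ.* (y₁ ℤ.+ (c ℤ.* q₁ ℤ.+ δ ℤ.* (+ 0 ℤ.* q₂)))
          ℤ.- δ ℤ.* ((y₂ ℤ.+ (c ℤ.* q₂ ℤ.+ + 0 ℤ.* q₁)) ℤ.* (y₂ ℤ.+ (c ℤ.* q₂ ℤ.+ + 0 ℤ.* q₁)))
          ℤ.- (y₁ ℤ.* y₁ ℤ.- δ ℤ.* (y₂ ℤ.* y₂))
        ≡ (+ 2 ℤ.* y₁ ℤ.* q₁ ℤ.+ c ℤ.* q₁ ℤ.* q₁ ℤ.- δ ℤ.* (+ 2 ℤ.* y₂ ℤ.* q₂ ℤ.+ c ℤ.* q₂ ℤ.* q₂)) ℤ.* c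
      expand = solve-∀

  Odd : ℤ → Set
  Odd m = Σ ℤ λ t → m ≡ + 1 ℤ.+ + 2 ℤ.* t

  odd-* : ∀ {m n} → Odd m → Odd n → Odd (m ℤ.* n)
  odd-* (s , refl) (t , refl) = s ℤ.+ t ℤ.+ + 2 ℤ.* (s ℤ.* t) , expand s t
    where
    expand : ∀ s t → (+ 1 ℤ.+ + 2 ℤ.* s) ℤ.* (+ 1 ℤ.+ + 2 ℤ.* t) ≡ + 1 ℤ.+ + 2 ℤ.* (s ℤ.+ t ℤ.+ + 2 ℤ.* (s ℤ.* t))
    expand = solve-∀

  opaque
    unfolding plus times negate two^
    unit⇒odd-N : ∀ {u} → Unit u → Odd (N u)
    unit⇒odd-N {a , b} (unit u²) with ≈⇒Cong u²
    ... | d , _ with ℤ.∣ᵤ⇒∣ {+ 2} {a ℤ.* a ℤ.+ D F ℤ.* (b ℤ.* b) ℤ.- + 1} d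
    ... | ℤ.divides q e = q ℤ.- D F ℤ.* (b ℤ.* b) , (begin
      a ℤ.* a ℤ.- D F ℤ.* (b ℤ.* b)                       ≡⟨ split (D F) a b ⟩
      (a ℤ.* a ℤ.+ D F ℤ.* (b ℤ.* b) ℤ.- + 1) ℤ.+ r       ≡⟨ cong (ℤ._+ r) e ⟩
      q ℤ.* + 2 ℤ.+ r                                     ≡⟨ regroup (D F) b q ⟩
      + 1 ℤ.+ + 2 ℤ.* (q ℤ.- D F ℤ.* (b ℤ.* b))            ∎)
      where
      open ≡-Reasoning
      r : ℤ
      r = + 1 ℤ.- + 2 ℤ.* (D F ℤ.* (b ℤ.* b))
      split : ∀ δ a b → a ℤ.* a ℤ.- δ ℤ.* (b ℤ.* b)
                        ≡ (a ℤ.* a ℤ.+ δ ℤ.* (b ℤ.* b) ℤ.- + 1) ℤ.+ (+ 1 ℤ.- + 2 ℤ.* (δ ℤ.* (b ℤ.* b)))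
      split = solve-∀
      regroup : ∀ δ b q → q ℤ.* + 2 ℤ.+ (+ 1 ℤ.- + 2 ℤ.* (δ ℤ.* (b ℤ.* b))) ≡ + 1 ℤ.+ + 2 ℤ.* (q ℤ.- δ ℤ.* (b ℤ.* b))
      regroup = solve-∀

  N-π : Σ ℤ λ m → Odd m × N π ≡ + 2 ℤ.* m
  N-π with D≡-1-4t F
  ... | t , D≡ = + 1 ℤ.+ + 2 ℤ.* t , (t , refl) ,
    trans (cong N π≡πα) (trans (cong (λ δ → + 1 ℤ.* + 1 ℤ.- δ ℤ.* (+ 1 ℤ.* + 1)) D≡) (compute t))
    where
    compute : ∀ t → + 1 ℤ.* + 1 ℤ.- (ℤ.- + 1 ℤ.- + 4 ℤ.* t) ℤ.* (+ 1 ℤ.* + 1) ≡ + 2 ℤ.* (+ 1 ℤ.+ + 2 ℤ.* t)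
    compute = solve-∀

  N-π^⊛ : ∀ r {u} → Unit u → Σ ℤ λ m → Odd m × N (π ^ r ⊛ u) ≡ + (2 ℕ.^ r) ℤ.* m
  N-π^⊛ zero {u} u-unit = N u , unit⇒odd-N u-unit ,
    trans (cong N (⊛-identityˡ u)) (sym (ℤ.*-identityˡ (N u)))
  N-π^⊛ (suc r) {u} u-unit with N-π | N-π^⊛ r u-unit
  ... | o , o-odd , Nπ | m , m-odd , Nπʳu = o ℤ.* m , odd-* o-odd m-odd , (begin
    N (π ^ suc r ⊛ u)                               ≡⟨ cong N (⊛-assoc π (π ^ r) u) ⟩
    N (π ⊛ (π ^ r ⊛ u))                             ≡⟨ N-⊛ π (π ^ r ⊛ u) ⟩
    N π ℤ.* N (π ^ r ⊛ u)                           ≡⟨ cong₂ ℤ._*_ Nπ Nπʳu ⟩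
    (+ 2 ℤ.* o) ℤ.* (+ (2 ℕ.^ r) ℤ.* m)             ≡⟨ regroup (+ (2 ℕ.^ r)) o m ⟩
    (+ 2 ℤ.* + (2 ℕ.^ r)) ℤ.* (o ℤ.* m)             ≡⟨ cong (ℤ._* (o ℤ.* m)) (ℤ.pos-* 2 (2 ℕ.^ r)) ⟨
    + (2 ℕ.^ suc r) ℤ.* (o ℤ.* m)                   ∎)
    where
    open ≡-Reasoning
    regroup : ∀ c o m → (+ 2 ℤ.* o) ℤ.* (c ℤ.* m) ≡ (+ 2 ℤ.* c) ℤ.* (o ℤ.* m)
    regroup = solve-∀

  N-odd-part-≉ : ∀ r {m x y} → Odd m → N x ≡ + (2 ℕ.^ r) ℤ.* m →
                 + (2 ℕ.^ suc r) ℤ.∣ N y → ¬ x ≈[ suc r ] y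
  N-odd-part-≉ r {m} {x} {y} (t , refl) Nx 2ʳ⁺¹∣Ny x≈y = 2∤1 (ℕ.∣1⇒≡1 (ℤ.∣⇒∣ᵤ 2∣1))
    where
    cancel : ∀ a b → a ℤ.- b ℤ.+ b ≡ a
    cancel = solve-∀
    2ʳ⁺¹∣Nx : + (2 ℕ.^ suc r) ℤ.∣ N x
    2ʳ⁺¹∣Nx = subst (_ ℤ.∣_) (cancel (N x) (N y)) (ℤ.∣m∣n⇒∣m+n (N-cong x≈y) 2ʳ⁺¹∣Ny)
    2∣m : + 2 ℤ.∣ m
    2∣m = ℤ.*-cancelˡ-∣ (+ (2 ℕ.^ r)) {{ℕ.m^n≢0 2 r}}
            (subst₂ ℤ._∣_ (trans (cong +_ (ℕ.*-comm 2 (2 ℕ.^ r))) (ℤ.pos-* (2 ℕ.^ r) 2)) Nx 2ʳ⁺¹∣Nx)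
    2∣1 : + 2 ℤ.∣ + 1
    2∣1 = ℤ.∣m+n∣n⇒∣m 2∣m (ℤ.divides t (ℤ.*-comm (+ 2) t))
    2∤1 : ¬ 2 ≡ 1
    2∤1 ()

  2^-mono-∣ : ∀ {m n} → m ℕ.≤ n → 2 ℕ.^ m ℕ.∣ 2 ℕ.^ n
  2^-mono-∣ {m} m≤n with ℕ.m≤n⇒∃[o]m+o≡n m≤n
  ... | o , refl = subst (2 ℕ.^ m ℕ.∣_) (sym (ℕ.^-distribˡ-+-* 2 m o)) (ℕ.m∣m*n (2 ℕ.^ o))

  π^⊛unit-≉ : ∀ {r s u v} → r < s → Unit u → Unit v → ¬ π ^ r ⊛ u ≈[ suc r ] π ^ s ⊛ v
  π^⊛unit-≉ {r} {s} r<s u-unit v-unit with N-π^⊛ r u-unit | N-π^⊛ s v-unit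
  ... | m , m-odd , Nx | m′ , _ , Ny = N-odd-part-≉ r m-odd Nx (subst (_ ℤ.∣_) (sym Ny) 2ʳ⁺¹∣2ˢm′)
    where
    2ʳ⁺¹∣2ˢm′ : + (2 ℕ.^ suc r) ℤ.∣ + (2 ℕ.^ s) ℤ.* m′
    2ʳ⁺¹∣2ˢm′ = ℤ.∣m⇒∣m*n m′ (ℤ.∣ᵤ⇒∣ {+ (2 ℕ.^ suc r)} {+ (2 ℕ.^ s)} (2^-mono-∣ r<s))

  π^⊛unit≉𝟘 : ∀ r {u} → Unit u → ¬ π ^ r ⊛ u ≈[ suc r ] 𝟘
  π^⊛unit≉𝟘 r u-unit with N-π^⊛ r u-unit
  ... | m , m-odd , Nx = N-odd-part-≉ r m-odd Nx (ℤ.divides (+ 0) (N𝟘 (D F) (+ (2 ℕ.^ suc r))))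
    where
    N𝟘 : ∀ δ c → + 0 ℤ.* + 0 ℤ.- δ ℤ.* (+ 0 ℤ.* + 0) ≡ + 0 ℤ.* c
    N𝟘 = solve-∀

  -- Hensel lifting of sixth roots

  binomialRemainder : ℕ → Zα → Zα → Zα
  binomialRemainder zero    x h = 𝟘
  binomialRemainder (suc m) x h =
    x ⊛ binomialRemainder m x h ⊕ ι (+ suc m) ⊛ x ^ m ⊕ h ⊛ binomialRemainder m x h

  binomial : ∀ m x h →
    (x ⊕ h) ^ suc m ≡ x ^ suc m ⊕ ι (+ suc m) ⊛ (x ^ m ⊛ h) ⊕ (h ⊛ h) ⊛ binomialRemainder m x h
  binomial zero x h =
    solve 2 (λ x h → (x :+ h) :* con (+ 1) := x :* con (+ 1) :+ con (+ 1) :* (con (+ 1) :* h) :+ (h :* h) :* con (+ 0))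
      refl x h
  binomial (suc m) x h = begin
    (x ⊕ h) ⊛ (x ⊕ h) ^ suc m
      ≡⟨ cong ((x ⊕ h) ⊛_) (binomial m x h) ⟩
    (x ⊕ h) ⊛ (x ^ suc m ⊕ K ⊛ (x ^ m ⊛ h) ⊕ (h ⊛ h) ⊛ B)
      ≡⟨ step x h (x ^ m) B K ⟩
    x ^ suc (suc m) ⊕ (𝟙 ⊕ K) ⊛ (x ^ suc m ⊛ h) ⊕ (h ⊛ h) ⊛ binomialRemainder (suc m) x h
      ≡⟨ cong (λ K′ → x ^ suc (suc m) ⊕ K′ ⊛ (x ^ suc m ⊛ h) ⊕ (h ⊛ h) ⊛ binomialRemainder (suc m) x h) (ι-⊕ (+ 1) (+ suc m)) ⟨
    x ^ suc (suc m) ⊕ ι (+ suc (suc m)) ⊛ (x ^ suc m ⊛ h) ⊕ (h ⊛ h) ⊛ binomialRemainder (suc m) x h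
      ∎
    where
    open ≡-Reasoning
    K B : Zα
    K = ι (+ suc m)
    B = binomialRemainder m x h
    step : ∀ x h X B K → (x ⊕ h) ⊛ (x ⊛ X ⊕ K ⊛ (X ⊛ h) ⊕ (h ⊛ h) ⊛ B)
                         ≡ x ⊛ (x ⊛ X) ⊕ (𝟙 ⊕ K) ⊛ ((x ⊛ X) ⊛ h) ⊕ (h ⊛ h) ⊛ (x ⊛ B ⊕ K ⊛ X ⊕ h ⊛ B)
    step = solve 5 (λ x h X B K → (x :+ h) :* (x :* X :+ K :* (X :* h) :+ (h :* h) :* B)
                                 := x :* (x :* X) :+ (con (+ 1) :+ K) :* ((x :* X) :* h) :+ (h :* h) :* (x :* B :+ K :* X :+ h :* B)) refl

  y⁶≈𝟙 : ∀ {y} → Unit y → y ^ 6 ≈[ 1 ] 𝟙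
  y⁶≈𝟙 {y} (unit y²≈𝟙) = begin
    y ^ 6          ≡⟨ solve 1 (λ y → y :^ 6 := (y :* y) :^ 3) refl y ⟩
    (y ⊛ y) ^ 3    ≈⟨ ^-cong 3 y²≈𝟙 ⟩
    𝟙 ^ 3          ≡⟨ 𝟙^ 3 ⟩
    𝟙              ∎
    where open SetoidReasoning (≈-setoid 1)

  module Lift (U S : ℕ → Zα)
              (U-coherent : ∀ n → U (suc n) ≈[ n ] U n)
              (S-coherent : ∀ n → S (suc n) ≈[ n ] S n)
              (U-unit : ∀ n → Unit (U n))
              (y₀ : Zα) (y₀-unit : Unit y₀) (y₀-root : U 3 ⊛ y₀ ^ 6 ≈[ 3 ] S 3) where

    record Approximation (j : ℕ) : Set where
      constructor approximation
      field
        root : Zα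
        root-unit : Unit root
        root-solves : U (3 ℕ.+ j) ⊛ root ^ 6 ≈[ 3 ℕ.+ j ] S (3 ℕ.+ j)
    open Approximation

    -- Newton's step y ↦ y - f(y)/f′(y) for f(y) = u y⁶ - s.  Since f′(y) = 6 u y⁵ and u y is
    -- an inverse of u y⁵ modulo 2, the correction -u y (f(y)/2) is good enough.
    module Step {j} (a : Approximation j) where
      u s y f C : Zα
      u = U (4 ℕ.+ j)
      s = S (4 ℕ.+ j)
      y = root a
      f = u ⊛ y ^ 6 ⊖ s
      C = two^ (2 ℕ.+ j)

      f≈𝟘 : u ⊛ y ^ 6 ≈[ 3 ℕ.+ j ] s
      f≈𝟘 = begin
        u ⊛ y ^ 6                   ≈⟨ ⊛-cong (U-coherent (3 ℕ.+ j)) ≈-refl ⟩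
        U (3 ℕ.+ j) ⊛ y ^ 6         ≈⟨ root-solves a ⟩
        S (3 ℕ.+ j)                 ≈⟨ ≈-sym (S-coherent (3 ℕ.+ j)) ⟩
        s                           ∎
        where open SetoidReasoning (≈-setoid (3 ℕ.+ j))

      z : Zα
      z = quotient (divides-difference f≈𝟘)

      f≡2Cz : f ≡ ι (+ 2) ⊛ C ⊛ z
      f≡2Cz = trans (equality (divides-difference f≈𝟘))
                    (trans (cong (_⊛ z) (two^-+ 1 (2 ℕ.+ j))) (cong (λ T → T ⊛ C ⊛ z) (two^≡ 1)))

      h : Zα
      h = - ((u ⊛ y) ⊛ (C ⊛ z))

      2^[2+j]∣h : 2^ (2 ℕ.+ j) ∣ h
      2^[2+j]∣h = ∣-neg (∣-⊛ˡ (u ⊛ y) (∣-two^⊛ _ z))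

      y′ : Zα
      y′ = y ⊕ h

      y′≈y : ∀ {n} → n ≤ 2 ℕ.+ j → y′ ≈[ n ] y
      y′≈y {n} n≤ = begin
        y ⊕ h    ≈⟨ ⊕-cong (≈-refl {x = y}) (∣⇒≈𝟘 (∣-weaken n≤ 2^[2+j]∣h)) ⟩
        y ⊕ 𝟘    ≡⟨ ⊕-identityʳ y ⟩
        y        ∎
        where open SetoidReasoning (≈-setoid n)

      y′-unit : Unit y′
      y′-unit = unit (begin
        y′ ⊛ y′  ≈⟨ ⊛-cong (y′≈y (s≤s z≤n)) (y′≈y (s≤s z≤n)) ⟩
        y ⊛ y    ≈⟨ square≈𝟙 (root-unit a) ⟩
        𝟙        ∎)
        where open SetoidReasoning (≈-setoid 1)

      w R : Zα
      w = (u ⊛ u) ⊛ y ^ 6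
      R = binomialRemainder 5 y h

      error-identity : u ⊛ y′ ^ 6 ⊖ s ≡ (𝟙 ⊖ ι (+ 3) ⊛ w) ⊛ f ⊕ (h ⊛ h) ⊛ (u ⊛ R)
      error-identity = begin
        u ⊛ y′ ^ 6 ⊖ s
          ≡⟨ cong (λ t → u ⊛ t ⊖ s) (binomial 5 y h) ⟩
        u ⊛ (y ⊛ y ^ 5 ⊕ ι (+ 6) ⊛ (y ^ 5 ⊛ h) ⊕ (h ⊛ h) ⊛ R) ⊖ s
          ≡⟨ expand u y (y ^ 5) C z ((h ⊛ h) ⊛ R) s ⟩
        f ⊖ ι (+ 3) ⊛ w ⊛ (ι (+ 2) ⊛ C ⊛ z) ⊕ u ⊛ ((h ⊛ h) ⊛ R)
          ≡⟨ cong (λ t → f ⊖ ι (+ 3) ⊛ w ⊛ t ⊕ u ⊛ ((h ⊛ h) ⊛ R)) f≡2Cz ⟨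
        f ⊖ ι (+ 3) ⊛ w ⊛ f ⊕ u ⊛ ((h ⊛ h) ⊛ R)
          ≡⟨ solve 5 (λ f w u H R → f :- con (+ 3) :* w :* f :+ u :* (H :* R) := (con (+ 1) :- con (+ 3) :* w) :* f :+ H :* (u :* R))
                     refl f w u (h ⊛ h) R ⟩
        (𝟙 ⊖ ι (+ 3) ⊛ w) ⊛ f ⊕ (h ⊛ h) ⊛ (u ⊛ R)
          ∎
        where
        open ≡-Reasoning
        expand : ∀ u y Y C z H s →
          u ⊛ (y ⊛ Y ⊕ ι (+ 6) ⊛ (Y ⊛ - ((u ⊛ y) ⊛ (C ⊛ z))) ⊕ H) ⊖ s
            ≡ u ⊛ (y ⊛ Y) ⊖ s ⊖ ι (+ 3) ⊛ ((u ⊛ u) ⊛ (y ⊛ Y)) ⊛ (ι (+ 2) ⊛ C ⊛ z) ⊕ u ⊛ H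
        expand = solve 7 (λ u y Y C z H s →
          u :* (y :* Y :+ con (+ 6) :* (Y :* :- ((u :* y) :* (C :* z))) :+ H) :- s
            := u :* (y :* Y) :- s :- con (+ 3) :* ((u :* u) :* (y :* Y)) :* (con (+ 2) :* C :* z) :+ u :* H) refl

      2∣𝟙-3w : 2^ 1 ∣ 𝟙 ⊖ ι (+ 3) ⊛ w
      2∣𝟙-3w = ≈-∣ 𝟙-3w≈-2 (divides (ι -[1+ 0 ])
        (trans (solve 0 (con (+ 1) :- con (+ 3) :* con (+ 1) := con (+ 2) :* con -[1+ 0 ]) refl)
               (cong (_⊛ ι -[1+ 0 ]) (sym (two^≡ 1)))))
        where
        𝟙-3w≈-2 : 𝟙 ⊖ ι (+ 3) ⊛ w ≈[ 1 ] 𝟙 ⊖ ι (+ 3) ⊛ 𝟙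
        𝟙-3w≈-2 = ⊕-cong (≈-refl {x = 𝟙}) (neg-cong (⊛-cong (≈-refl {x = ι (+ 3)}) (begin
          (u ⊛ u) ⊛ y ^ 6   ≈⟨ ⊛-cong (square≈𝟙 (U-unit (4 ℕ.+ j))) (y⁶≈𝟙 (root-unit a)) ⟩
          𝟙 ⊛ 𝟙             ≡⟨ ⊛-identityˡ 𝟙 ⟩
          𝟙                 ∎)))
          where open SetoidReasoning (≈-setoid 1)

      next : Approximation (suc j)
      next = approximation y′ y′-unit
        (mk≈ (∣-resp (sym error-identity)
          (∣-⊕ (∣-⊛ 2∣𝟙-3w (divides-difference f≈𝟘))
               (∣-⊛ʳ (u ⊛ R) (∣-weaken (ℕ.+-monoʳ-≤ 2 (ℕ.m≤n+m (2 ℕ.+ j) j)) (∣-⊛ 2^[2+j]∣h 2^[2+j]∣h))))))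

    approximations : ∀ j → Approximation j
    approximations zero    = approximation y₀ y₀-unit y₀-root
    approximations (suc j) = Step.next (approximations j)

    roots : ℕ → Zα
    roots j = root (approximations j)

    roots-coherent : ∀ j → roots (suc j) ≈[ j ] roots j
    roots-coherent j = Step.y′≈y (approximations j) (ℕ.m≤n+m j 2)

    roots-solve : ∀ n → U n ⊛ roots n ^ 6 ≈[ n ] S n
    roots-solve n = begin
      U n ⊛ roots n ^ 6              ≈⟨ ⊛-cong (≈-sym (coherent-+ U U-coherent 3 n)) ≈-refl ⟩
      U (3 ℕ.+ n) ⊛ roots n ^ 6      ≈⟨ ≈-weaken (ℕ.m≤n+m n 3) (root-solves (approximations n)) ⟩
      S (3 ℕ.+ n)                    ≈⟨ coherent-+ S S-coherent 3 n ⟩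
      S n                            ∎
      where open SetoidReasoning (≈-setoid n)

  -- Expansions a = π^r (1 + c π + π² y)

  π^≡ : ∀ k → π ^ k ≡ _^α_ F (πα F) k
  π^≡ k = trans (cong (_^ k) π≡πα) (^≡^α (πα F) k)

  2∣π² : 2^ 1 ∣ π ^ 2
  2∣π² with π²≡2ρ F
  ... | ρ , π²≡ = divides ρ (trans (π^≡ 2) (trans π²≡ (trans (sym (⊛≡*α (ι (+ 2)) ρ)) (cong (_⊛ ρ) (sym (two^≡ 1))))))

  unitFactor : Bool → Zα → Zα
  unitFactor c y = 𝟙 ⊕ digit F c ⊕ π ^ 2 ⊛ y

  unitFactor≈ : ∀ c y → unitFactor c y ≈[ 1 ] 𝟙 ⊕ digit F c
  unitFactor≈ c y = begin
    𝟙 ⊕ digit F c ⊕ π ^ 2 ⊛ y   ≈⟨ ⊕-cong (≈-refl {x = 𝟙 ⊕ digit F c}) (∣⇒≈𝟘 (∣-⊛ʳ y 2∣π²)) ⟩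
    𝟙 ⊕ digit F c ⊕ 𝟘           ≡⟨ ⊕-identityʳ _ ⟩
    𝟙 ⊕ digit F c               ∎
    where open SetoidReasoning (≈-setoid 1)

  unitFactor-unit : ∀ c y → Unit (unitFactor c y)
  unitFactor-unit c y = unit (≈-trans (⊛-cong (unitFactor≈ c y) (unitFactor≈ c y)) (digit-square c))
    where
    digit-square : ∀ c → (𝟙 ⊕ digit F c) ⊛ (𝟙 ⊕ digit F c) ≈[ 1 ] 𝟙
    digit-square false = ≈-reflexive (solve 0 ((con (+ 1) :+ con (+ 0)) :* (con (+ 1) :+ con (+ 0)) := con (+ 1)) refl)
    digit-square true  = subst (λ p → (𝟙 ⊕ p) ⊛ (𝟙 ⊕ p) ≈[ 1 ] 𝟙) π≡πα
      (mk≈ (∣-resp (square π) (∣-⊕ 2∣π² (subst (λ T → 2^ 1 ∣ T ⊛ π) (two^≡ 1) (∣-two^⊛ 1 π)))))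
      where
      square : ∀ p → p ^ 2 ⊕ ι (+ 2) ⊛ p ≡ (𝟙 ⊕ p) ⊛ (𝟙 ⊕ p) ⊖ 𝟙
      square = solve 1 (λ p → p :^ 2 :+ con (+ 2) :* p := (con (+ 1) :+ p) :* (con (+ 1) :+ p) :- con (+ 1)) refl

  unitFactor-cong : ∀ {n} c {y y′} → y ≈[ n ] y′ → unitFactor c y ≈[ n ] unitFactor c y′
  unitFactor-cong c {y} y≈y′ = ⊕-cong (≈-refl {x = 𝟙 ⊕ digit F c}) (⊛-cong (≈-refl {x = π ^ 2}) y≈y′)

  record Leading (a : 𝒪) (ℓ : ℕ) (c : Bool) : Set where
    field
      valuation : ℕ
      valuation≡ℓ : valuation % 6 ≡ ℓ % 6
      rest : 𝒪
      expansion : ∀ n → approx a n ≈[ n ] π ^ valuation ⊛ unitFactor c (approx rest n)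
  open Leading public

  leading : ∀ {a ℓ c} → LevelCoef F a ℓ c → Leading a ℓ c
  leading {a} {ℓ} {c} (r , r≡ℓ , y , a-expansion) = record
    { valuation = r ; valuation≡ℓ = r≡ℓ ; rest = y ; expansion = expansion′ }
    where
    expansion′ : ∀ n → approx a n ≈[ n ] π ^ r ⊛ unitFactor c (approx y n)
    expansion′ n = begin
      A                              ≡⟨ solve 2 (λ A B → A := (A :- B) :+ B) refl A B ⟩
      (A ⊖ B) ⊕ B                    ≈⟨ ⊕-cong (Cong⇒≈ {x = A ⊖ B} {π ^ (r ℕ.+ 2) ⊛ Y}
                                                         (subst₂ (Cong n) (sym bridgeˡ) (sym bridgeʳ) (a-expansion n)))
                                               (≈-refl {x = B}) ⟩
      π ^ (r ℕ.+ 2) ⊛ Y ⊕ B          ≡⟨ cong (λ P → P ⊛ Y ⊕ B) (^-+ π r 2) ⟩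
      (π ^ r ⊛ π ^ 2) ⊛ Y ⊕ B        ≡⟨ regroup (π ^ r) (π ^ 2) (digit F c) Y ⟩
      π ^ r ⊛ unitFactor c Y         ∎
      where
      open SetoidReasoning (≈-setoid n)
      A B Y : Zα
      A = approx a n
      B = π ^ r ⊛ (𝟙 ⊕ digit F c)
      Y = approx y n
      bridgeˡ : A ⊖ B ≡ _-α_ F A (_*α_ F (_^α_ F (πα F) r) (_+α_ F 𝟙 (digit F c)))
      bridgeˡ = trans (⊖≡-α A B) (cong (_-α_ F A)
        (trans (⊛≡*α (π ^ r) (𝟙 ⊕ digit F c)) (cong₂ (_*α_ F) (π^≡ r) (⊕≡+α 𝟙 (digit F c)))))
      bridgeʳ : π ^ (r ℕ.+ 2) ⊛ Y ≡ _*α_ F (_^α_ F (πα F) (r ℕ.+ 2)) Y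
      bridgeʳ = trans (⊛≡*α (π ^ (r ℕ.+ 2)) Y) (cong (λ P → _*α_ F P Y) (π^≡ (r ℕ.+ 2)))
      regroup : ∀ P Q d Y → (P ⊛ Q) ⊛ Y ⊕ P ⊛ (𝟙 ⊕ d) ≡ P ⊛ (𝟙 ⊕ d ⊕ Q ⊛ Y)
      regroup = solve 4 (λ P Q d Y → (P :* Q) :* Y :+ P :* (con (+ 1) :+ d) := P :* (con (+ 1) :+ d :+ Q :* Y)) refl

  valuation-unique : ∀ {a ℓ ℓ′ c c′} (L : Leading a ℓ c) (L′ : Leading a ℓ′ c′) → valuation L ≡ valuation L′
  valuation-unique {a} {c = c} {c′} L L′ with ℕ.<-cmp (valuation L) (valuation L′)
  ... | tri≈ _ r≡s _ = r≡s
  ... | tri< r<s _ _ = ⊥-elim (π^⊛unit-≉ r<s (unitFactor-unit c _) (unitFactor-unit c′ _)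
                                (≈-trans (≈-sym (expansion L _)) (expansion L′ _)))
  ... | tri> _ _ s<r = ⊥-elim (π^⊛unit-≉ s<r (unitFactor-unit c′ _) (unitFactor-unit c _)
                                (≈-trans (≈-sym (expansion L′ _)) (expansion L _)))

  level-unique : ∀ {a ℓ ℓ′ c c′} → Leading a ℓ c → Leading a ℓ′ c′ → ℓ % 6 ≡ ℓ′ % 6
  level-unique L L′ = trans (sym (valuation≡ℓ L)) (trans (cong (_% 6) (valuation-unique L L′)) (valuation≡ℓ L′))

  -- The residue computations

  seed γ : Fin 4 → Zα
  seed = lookup (seeds F)
  γ = lookup (γs F)

  bit : Bool → Zα
  bit true  = 𝟙
  bit false = 𝟘

  fromFin : ∀ {m} → Fin m → Fin m → Zα
  fromFin a b = (+ toℕ a , + toℕ b)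

  -- Modulo 8 = π⁶·unit, an equation u₁ y₀⁶ + u₂ + π³ u₃ z + π⁴ u₄ t ≡ 0 divided by π² becomes
  -- bracket ≡ 0 modulo 4, where u₂ = u₁ + π² d.
  bracket : Fin 4 → (u₁ d u₃ u₄ : Zα) (z t : Bool) → Zα
  bracket k u₁ d u₃ u₄ z t = u₁ ⊛ γ k ⊕ d ⊕ (π ⊛ u₃ ⊛ bit z ⊕ π ^ 2 ⊛ u₄ ⊛ bit t)

  ResidueClaim : Set
  ResidueClaim = ∀ (c c₃ c₄ : Bool) (a₁ b₁ a₃ b₃ : Fin 2) (e f : Fin 4) →
    Σ Bool λ z → Σ Bool λ t → Σ (Fin 4) λ k →
      Cong 2 (bracket k (unitFactor c (fromFin a₁ b₁)) (fromFin e f) (unitFactor c₃ (fromFin a₃ b₃)) (𝟙 ⊕ digit F c₄) z t) 𝟘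

  opaque
    unfolding plus times negate uniformizer
    residueClaim? : Dec ResidueClaim
    residueClaim? =
      all-Bool? λ c → all-Bool? λ c₃ → all-Bool? λ c₄ → all? λ a₁ → all? λ b₁ → all? λ a₃ → all? λ b₃ → all? λ e → all? λ f →
      any-Bool? λ z → any-Bool? λ t → any? λ k →
      Cong? 2 (bracket k (unitFactor c (fromFin a₁ b₁)) (fromFin e f) (unitFactor c₃ (fromFin a₃ b₃)) (𝟙 ⊕ digit F c₄) z t) 𝟘

  SeedFacts : Set
  SeedFacts = ∀ k → Cong 1 (seed k ⊛ seed k) 𝟙 × Cong 3 (seed k ^ 6 ⊕ 𝟙) (π ^ 2 ⊛ γ k)

  opaque
    unfolding plus times negate uniformizer
    seedFacts? : Dec SeedFacts
    seedFacts? = all? λ k → Cong? 1 (seed k ⊛ seed k) 𝟙 ×-dec Cong? 3 (seed k ^ 6 ⊕ 𝟙) (π ^ 2 ⊛ γ k)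

  π²⊛-cong : ∀ {y y′} → y ≈[ 1 ] y′ → π ^ 2 ⊛ y ≈[ 2 ] π ^ 2 ⊛ y′
  π²⊛-cong {y} {y′} (mk≈ d) = mk≈ (∣-resp (distrib (π ^ 2) y y′) (∣-⊛ 2∣π² d))
    where
    distrib : ∀ P y y′ → P ⊛ (y ⊖ y′) ≡ P ⊛ y ⊖ P ⊛ y′
    distrib = solve 3 (λ P y y′ → P :* (y :- y′) := P :* y :- P :* y′) refl

  others : Bool → Bool → Bool → Zα → Zα → Zα → Bool → Bool → Zα
  others c c₃ c₄ y₂ y₃ y₄ z t = unitFactor c y₂ ⊕ π ^ 3 ⊛ unitFactor c₃ y₃ ⊛ bit z ⊕ π ^ 4 ⊛ unitFactor c₄ y₄ ⊛ bit t

  others-cong : ∀ {n} (c c₃ c₄ : Bool) {y₂ y₂′ y₃ y₃′ y₄ y₄′ : Zα} (z t : Bool) →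
    y₂ ≈[ n ] y₂′ → y₃ ≈[ n ] y₃′ → y₄ ≈[ n ] y₄′ →
    others c c₃ c₄ y₂ y₃ y₄ z t ≈[ n ] others c c₃ c₄ y₂′ y₃′ y₄′ z t
  others-cong c c₃ c₄ z t y₂≈ y₃≈ y₄≈ =
    ⊕-cong (⊕-cong (unitFactor-cong c y₂≈) (⊛-cong (⊛-cong (≈-refl {x = π ^ 3}) (unitFactor-cong c₃ y₃≈)) (≈-refl {x = bit z})))
           (⊛-cong (⊛-cong (≈-refl {x = π ^ 4}) (unitFactor-cong c₄ y₄≈)) (≈-refl {x = bit t}))

  open Sum (CommutativeRing.+-commutativeMonoid commutativeRing) public using (sum; sum-replicate-zero; sum-cong-≗)

  opaque
    unfolding plus
    sumα≡sum : (t : Vector Zα 7) → sumα F (List.map t (List.allFin 7)) ≡ sum t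
    sumα≡sum t = refl

  sum-updateAt : ∀ {n} (t : Vector Zα n) i v → t i ≡ 𝟘 → sum (updateAt t i (const v)) ≡ sum t ⊕ v
  sum-updateAt t zero    v t₀≡𝟘 = begin
    v ⊕ sum (tail t)           ≡⟨ solve 2 (λ v s → v :+ s := (con (+ 0) :+ s) :+ v) refl v (sum (tail t)) ⟩
    (𝟘 ⊕ sum (tail t)) ⊕ v     ≡⟨ cong (λ z → (z ⊕ sum (tail t)) ⊕ v) t₀≡𝟘 ⟨
    (t zero ⊕ sum (tail t)) ⊕ v ∎
    where open ≡-Reasoning
  sum-updateAt t (suc i) v tᵢ≡𝟘 = begin
    t zero ⊕ sum (updateAt (tail t) i (const v))  ≡⟨ cong (t zero ⊕_) (sum-updateAt (tail t) i v tᵢ≡𝟘) ⟩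
    t zero ⊕ (sum (tail t) ⊕ v)                    ≡⟨ solve 3 (λ a s v → a :+ (s :+ v) := (a :+ s) :+ v) refl (t zero) (sum (tail t)) v ⟩
    (t zero ⊕ sum (tail t)) ⊕ v                    ∎
    where open ≡-Reasoning

  updateAt-pointwise : ∀ {A B : Set} {n} (g : Fin n → A → B) (x : Vector A n) i v →
    ∀ m → g m (updateAt x i (const v) m) ≡ updateAt (λ m → g m (x m)) i (const (g i v)) m
  updateAt-pointwise g x i v m with m ≟ i
  ... | yes refl = trans (cong (g m) (updateAt-updates m x)) (sym (updateAt-updates m _))
  ... | no m≢i  = trans (cong (g m) (updateAt-minimal m i x m≢i)) (sym (updateAt-minimal m i _ m≢i))

  const𝒪 : Zα → 𝒪
  const𝒪 v = record { approx = λ _ → v ; coh = λ n → ≈⇒Cong (≈-refl {n} {v}) }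

  coherent𝒪 : (s : ℕ → Zα) → (∀ n → s (suc n) ≈[ n ] s n) → 𝒪
  coherent𝒪 s s-coherent = record { approx = s ; coh = λ n → ≈⇒Cong (s-coherent n) }

  distinct-indices : ∀ (a : Fin 7 → 𝒪) {i j ℓ ℓ′ c c′} →
                     Leading (a i) ℓ c → Leading (a j) ℓ′ c′ → ℓ % 6 ≢ ℓ′ % 6 → i ≢ j
  distinct-indices a L L′ ℓ≢ℓ′ refl = ℓ≢ℓ′ (level-unique L L′)

  bit⁶ : ∀ b → bit b ^ 6 ≡ bit b
  bit⁶ true  = 𝟙^ 6
  bit⁶ false = 𝟘^suc 5

  scale⁶ : ∀ (P : Zα) (r e : ℕ) (u X : Zα) → (P ^ r ⊛ u) ⊛ (P ^ e ⊛ X) ^ 6 ≡ P ^ (r ℕ.+ e ℕ.* 6) ⊛ (u ⊛ X ^ 6)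
  scale⁶ P r e u X = begin
    (P ^ r ⊛ u) ⊛ (P ^ e ⊛ X) ^ 6          ≡⟨ cong ((P ^ r ⊛ u) ⊛_) (⊛-^ (P ^ e) X 6) ⟩
    (P ^ r ⊛ u) ⊛ ((P ^ e) ^ 6 ⊛ X ^ 6)    ≡⟨ cong (λ Q → (P ^ r ⊛ u) ⊛ (Q ⊛ X ^ 6)) (^-* P e 6) ⟩
    (P ^ r ⊛ u) ⊛ (P ^ (e ℕ.* 6) ⊛ X ^ 6)  ≡⟨ regroup (P ^ r) u (P ^ (e ℕ.* 6)) (X ^ 6) ⟩
    (P ^ r ⊛ P ^ (e ℕ.* 6)) ⊛ (u ⊛ X ^ 6)  ≡⟨ cong (_⊛ (u ⊛ X ^ 6)) (^-+ P r (e ℕ.* 6)) ⟨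
    P ^ (r ℕ.+ e ℕ.* 6) ⊛ (u ⊛ X ^ 6)      ∎
    where
    open ≡-Reasoning
    regroup : ∀ A u B X → (A ⊛ u) ⊛ (B ⊛ X) ≡ (A ⊛ B) ⊛ (u ⊛ X)
    regroup = solve 4 (λ A u B X → (A :* u) :* (B :* X) := (A :* B) :* (u :* X)) refl

  term≈ : ∀ {a : 𝒪} {ℓ : ℕ} {c : Bool} (L : Leading a ℓ c) (e : ℕ) {T : ℕ} → valuation L ℕ.+ e ℕ.* 6 ≡ T →
          (n : ℕ) (X : Zα) →
          approx a n ⊛ (π ^ e ⊛ X) ^ 6 ≈[ n ] π ^ T ⊛ (unitFactor c (approx (rest L) n) ⊛ X ^ 6)
  term≈ {a} {c = c} L e refl n X =
    scale-cong (approx a n) π (valuation L) e (unitFactor c (approx (rest L) n)) X (expansion L n)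
    where
    scale-cong : ∀ {n} (A P : Zα) (r e : ℕ) (u X : Zα) → A ≈[ n ] P ^ r ⊛ u →
                 A ⊛ (P ^ e ⊛ X) ^ 6 ≈[ n ] P ^ (r ℕ.+ e ℕ.* 6) ⊛ (u ⊛ X ^ 6)
    scale-cong A P r e u X A≈ = ≈-trans (⊛-cong A≈ ≈-refl) (≈-reflexive (scale⁶ P r e u X))

  approx-coherent : ∀ Y n → approx Y (suc n) ≈[ n ] approx Y n
  approx-coherent Y n = Cong⇒≈ {x = approx Y (suc n)} {approx Y n} (coh Y n)

  sum-updateAt′ : ∀ {A : Set} {n} (g : Fin n → A → Zα) (x : Vector A n) i v → g i (x i) ≡ 𝟘 →
    sum (λ m → g m (updateAt x i (const v) m)) ≡ sum (λ m → g m (x m)) ⊕ g i v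
  sum-updateAt′ g x i v gᵢ≡𝟘 =
    trans (sum-cong-≗ (updateAt-pointwise g x i v)) (sum-updateAt (λ m → g m (x m)) i (g i v) gᵢ≡𝟘)

  module Construction (residueClaim : ResidueClaim) (seedFacts : SeedFacts) where
    -- By the choice of γ, u₁ y₀⁶ + others ≡ π² · bracket (mod 8).
    root-mod-8 : ∀ k c c₃ c₄ y₁ y₂ y₃ y₄ z t {ŷ₁ d̂ ŷ₃} →
      y₁ ≈[ 1 ] ŷ₁ → y₂ ⊖ y₁ ≈[ 2 ] d̂ → y₃ ≈[ 1 ] ŷ₃ →
      bracket k (unitFactor c ŷ₁) d̂ (unitFactor c₃ ŷ₃) (𝟙 ⊕ digit F c₄) z t ≈[ 2 ] 𝟘 →
      unitFactor c y₁ ⊛ seed k ^ 6 ≈[ 3 ] - others c c₃ c₄ y₂ y₃ y₄ z t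
    root-mod-8 k c c₃ c₄ y₁ y₂ y₃ y₄ z t y₁≈ d≈ y₃≈ bracket≈𝟘 =
      mk≈ (∣-resp (sym rearrange) (≈-∣ reduce (∣-⊛ 2∣π² 4∣B)))
      where
      u₁ u₃ u₄ d B : Zα
      u₁ = unitFactor c y₁
      u₃ = unitFactor c₃ y₃
      u₄ = unitFactor c₄ y₄
      d  = y₂ ⊖ y₁
      B  = bracket k u₁ d u₃ u₄ z t

      4∣B : 2^ 2 ∣ B
      4∣B = ≈-∣ (⊕-cong (⊕-cong (⊛-cong (⊕-cong (≈-refl {x = 𝟙 ⊕ digit F c}) (π²⊛-cong y₁≈)) (≈-refl {x = γ k})) d≈)
                        (⊕-cong (⊛-cong (⊛-cong (≈-refl {x = π}) (⊕-cong (≈-refl {x = 𝟙 ⊕ digit F c₃}) (π²⊛-cong y₃≈))) (≈-refl {x = bit z}))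
                                (⊛-cong (π²⊛-cong (unitFactor≈ c₄ y₄)) (≈-refl {x = bit t}))))
                (≈𝟘⇒∣ bracket≈𝟘)

      rearrange : u₁ ⊛ seed k ^ 6 ⊖ - others c c₃ c₄ y₂ y₃ y₄ z t
                  ≡ u₁ ⊛ (seed k ^ 6 ⊕ 𝟙) ⊕ π ^ 2 ⊛ (d ⊕ (π ⊛ u₃ ⊛ bit z ⊕ π ^ 2 ⊛ u₄ ⊛ bit t))
      rearrange = identity π (digit F c) y₁ y₂ u₃ u₄ (bit z) (bit t) (seed k ^ 6)
        where
        identity : ∀ P c y₁ y₂ u₃ u₄ bz bt X →
          (𝟙 ⊕ c ⊕ P ^ 2 ⊛ y₁) ⊛ X ⊖ - ((𝟙 ⊕ c ⊕ P ^ 2 ⊛ y₂) ⊕ P ^ 3 ⊛ u₃ ⊛ bz ⊕ P ^ 4 ⊛ u₄ ⊛ bt)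
            ≡ (𝟙 ⊕ c ⊕ P ^ 2 ⊛ y₁) ⊛ (X ⊕ 𝟙) ⊕ P ^ 2 ⊛ ((y₂ ⊖ y₁) ⊕ (P ⊛ u₃ ⊛ bz ⊕ P ^ 2 ⊛ u₄ ⊛ bt))
        identity = solve 9 (λ P c y₁ y₂ u₃ u₄ bz bt X →
          (con (+ 1) :+ c :+ P :^ 2 :* y₁) :* X :- (:- ((con (+ 1) :+ c :+ P :^ 2 :* y₂) :+ P :^ 3 :* u₃ :* bz :+ P :^ 4 :* u₄ :* bt))
            := (con (+ 1) :+ c :+ P :^ 2 :* y₁) :* (X :+ con (+ 1)) :+ P :^ 2 :* ((y₂ :- y₁) :+ (P :* u₃ :* bz :+ P :^ 2 :* u₄ :* bt)))
          refl

      reduce : u₁ ⊛ (seed k ^ 6 ⊕ 𝟙) ⊕ π ^ 2 ⊛ (d ⊕ (π ⊛ u₃ ⊛ bit z ⊕ π ^ 2 ⊛ u₄ ⊛ bit t)) ≈[ 3 ] π ^ 2 ⊛ B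
      reduce = begin
        u₁ ⊛ (seed k ^ 6 ⊕ 𝟙) ⊕ π ^ 2 ⊛ R
          ≈⟨ ⊕-cong (⊛-cong (≈-refl {x = u₁}) (Cong⇒≈ {x = seed k ^ 6 ⊕ 𝟙} {π ^ 2 ⊛ γ k} (proj₂ (seedFacts k))))
                    (≈-refl {x = π ^ 2 ⊛ R}) ⟩
        u₁ ⊛ (π ^ 2 ⊛ γ k) ⊕ π ^ 2 ⊛ (d ⊕ E)
          ≡⟨ factor u₁ (π ^ 2) (γ k) d E ⟩
        π ^ 2 ⊛ B
          ∎
        where
        open SetoidReasoning (≈-setoid 3)
        E R : Zα
        E = π ⊛ u₃ ⊛ bit z ⊕ π ^ 2 ⊛ u₄ ⊛ bit t
        R = d ⊕ E
        factor : ∀ u P g d E → u ⊛ (P ⊛ g) ⊕ P ⊛ (d ⊕ E) ≡ P ⊛ (u ⊛ g ⊕ d ⊕ E)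
        factor = solve 5 (λ u P g d E → u :* (P :* g) :+ P :* (d :+ E) := P :* (u :* g :+ d :+ E)) refl

    opaque
      seed-root : ∀ c c₃ c₄ y₁ y₂ y₃ y₄ → Σ Bool λ z → Σ Bool λ t → Σ (Fin 4) λ k →
        unitFactor c y₁ ⊛ seed k ^ 6 ≈[ 3 ] - others c c₃ c₄ y₂ y₃ y₄ z t
      seed-root c c₃ c₄ y₁ y₂ y₃ y₄ =
        let a₁ , b₁ , y₁≈ = residue 1 y₁
            e , f , d≈ = residue 2 (y₂ ⊖ y₁)
            a₃ , b₃ , y₃≈ = residue 1 y₃
            z , t , k , bracket≡𝟘 = residueClaim c c₃ c₄ a₁ b₁ a₃ b₃ e f
        in z , t , k , root-mod-8 k c c₃ c₄ y₁ y₂ y₃ y₄ z t y₁≈ d≈ y₃≈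
                         (Cong⇒≈ {x = bracket k (unitFactor c (fromFin a₁ b₁)) (fromFin e f) (unitFactor c₃ (fromFin a₃ b₃)) (𝟙 ⊕ digit F c₄) z t}
                                 bracket≡𝟘)

    module Assembly (a : Fin 7 → 𝒪) (k : Fin 6) (i j p q : Fin 7) (c c₃ c₄ : Bool) (i≢j : i ≢ j)
      (lc₁ : LevelCoef F (a i) (toℕ k) c) (lc₂ : LevelCoef F (a j) (toℕ k) c)
      (lc₃ : LevelCoef F (a p) (toℕ k ℕ.+ 3) c₃) (lc₄ : LevelCoef F (a q) (toℕ k ℕ.+ 4) c₄) where

      L₁ : Leading (a i) (toℕ k) c
      L₁ = leading lc₁
      L₂ : Leading (a j) (toℕ k) c
      L₂ = leading lc₂
      L₃ : Leading (a p) (toℕ k ℕ.+ 3) c₃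
      L₃ = leading lc₃
      L₄ : Leading (a q) (toℕ k ℕ.+ 4) c₄
      L₄ = leading lc₄

      i≢p : i ≢ p
      i≢p = distinct-indices a L₁ L₃ (proj₁ (levels-distinct k))
      i≢q : i ≢ q
      i≢q = distinct-indices a L₁ L₄ (proj₁ (proj₂ (levels-distinct k)))
      j≢p : j ≢ p
      j≢p = distinct-indices a L₂ L₃ (proj₁ (levels-distinct k))
      j≢q : j ≢ q
      j≢q = distinct-indices a L₂ L₄ (proj₁ (proj₂ (levels-distinct k)))
      p≢q : p ≢ q
      p≢q = distinct-indices a L₃ L₄ (proj₂ (proj₂ (levels-distinct k)))

      r₁ r₂ r₃ r₄ Σr : ℕ
      r₁ = valuation L₁
      r₂ = valuation L₂
      r₃ = valuation L₃
      r₄ = valuation L₄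
      Σr = r₁ ℕ.+ r₂ ℕ.+ r₃ ℕ.+ r₄

      -- Every a_m x_m⁶ becomes π^(ℓ + 6Σr) times a unit, where ℓ is the level of a_m.
      exponent : ∀ {b ℓ c′} (L : Leading b ℓ c′) → valuation L ≤ Σr →
                 Σ ℕ λ e → valuation L ℕ.+ e ℕ.* 6 ≡ ℓ ℕ.+ Σr ℕ.* 6
      exponent {ℓ = ℓ} L r≤Σr = congruent⇒+multiple 6 (valuation L) (ℓ ℕ.+ Σr ℕ.* 6)
        (trans (valuation≡ℓ L) (sym ([m+kn]%n≡m%n ℓ Σr 6)))
        (ℕ.≤-trans r≤Σr (ℕ.≤-trans (ℕ.m≤m*n Σr 6) (ℕ.m≤n+m (Σr ℕ.* 6) ℓ)))

      E₁ : Σ ℕ λ e → r₁ ℕ.+ e ℕ.* 6 ≡ toℕ k ℕ.+ Σr ℕ.* 6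
      E₁ = exponent L₁ (ℕ.≤-trans (ℕ.m≤m+n r₁ r₂) (ℕ.≤-trans (ℕ.m≤m+n _ r₃) (ℕ.m≤m+n _ r₄)))
      E₂ : Σ ℕ λ e → r₂ ℕ.+ e ℕ.* 6 ≡ toℕ k ℕ.+ Σr ℕ.* 6
      E₂ = exponent L₂ (ℕ.≤-trans (ℕ.m≤n+m r₂ r₁) (ℕ.≤-trans (ℕ.m≤m+n _ r₃) (ℕ.m≤m+n _ r₄)))
      E₃ : Σ ℕ λ e → r₃ ℕ.+ e ℕ.* 6 ≡ (toℕ k ℕ.+ 3) ℕ.+ Σr ℕ.* 6
      E₃ = exponent L₃ (ℕ.≤-trans (ℕ.m≤n+m r₃ (r₁ ℕ.+ r₂)) (ℕ.m≤m+n _ r₄))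
      E₄ : Σ ℕ λ e → r₄ ℕ.+ e ℕ.* 6 ≡ (toℕ k ℕ.+ 4) ℕ.+ Σr ℕ.* 6
      E₄ = exponent L₄ (ℕ.m≤n+m r₄ (r₁ ℕ.+ r₂ ℕ.+ r₃))

      M : ℕ
      M = toℕ k ℕ.+ Σr ℕ.* 6

      y₁ y₂ y₃ y₄ : ℕ → Zα
      y₁ = approx (rest L₁)
      y₂ = approx (rest L₂)
      y₃ = approx (rest L₃)
      y₄ = approx (rest L₄)

      base : Σ Bool λ z → Σ Bool λ t → Σ (Fin 4) λ s →
               unitFactor c (y₁ 3) ⊛ seed s ^ 6 ≈[ 3 ] - others c c₃ c₄ (y₂ 3) (y₃ 3) (y₄ 3) z t
      base = seed-root c c₃ c₄ (y₁ 3) (y₂ 3) (y₃ 3) (y₄ 3)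

      z t : Bool
      z = proj₁ base
      t = proj₁ (proj₂ base)
      s₀ : Fin 4
      s₀ = proj₁ (proj₂ (proj₂ base))

      others′ U S : ℕ → Zα
      others′ n = others c c₃ c₄ (y₂ n) (y₃ n) (y₄ n) z t
      U n = unitFactor c (y₁ n)
      S n = - others′ n

      S-coherent : ∀ n → S (suc n) ≈[ n ] S n
      S-coherent n = neg-cong {x = others′ (suc n)} {others′ n}
        (others-cong c c₃ c₄ z t (approx-coherent (rest L₂) n) (approx-coherent (rest L₃) n) (approx-coherent (rest L₄) n))

      open Lift U S (λ n → unitFactor-cong c (approx-coherent (rest L₁) n)) S-coherent (λ n → unitFactor-unit c (y₁ n))
                (seed s₀) (unit (Cong⇒≈ {x = seed s₀ ⊛ seed s₀} {𝟙} (proj₁ (seedFacts s₀)))) (proj₂ (proj₂ (proj₂ base)))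

      e₁ e₂ e₃ e₄ : ℕ
      e₁ = proj₁ E₁
      e₂ = proj₁ E₂
      e₃ = proj₁ E₃
      e₄ = proj₁ E₄

      X₁ X₂ X₃ X₄ zero𝒪 : 𝒪
      X₁ = coherent𝒪 (λ n → π ^ e₁ ⊛ roots n) (λ n → ⊛-cong (≈-refl {x = π ^ e₁}) (roots-coherent n))
      X₂ = const𝒪 (π ^ e₂ ⊛ 𝟙)
      X₃ = const𝒪 (π ^ e₃ ⊛ bit z)
      X₄ = const𝒪 (π ^ e₄ ⊛ bit t)
      zero𝒪 = const𝒪 𝟘

      x₁ x₂ x₃ x : Fin 7 → 𝒪
      x₁ = updateAt (const zero𝒪) i (const X₁)
      x₂ = updateAt x₁ j (const X₂)
      x₃ = updateAt x₂ p (const X₃)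
      x  = updateAt x₃ q (const X₄)

      term : ℕ → Fin 7 → 𝒪 → Zα
      term n m X = approx (a m) n ⊛ approx X n ^ 6

      term-zero : ∀ n m → term n m zero𝒪 ≡ 𝟘
      term-zero n m = trans (cong (approx (a m) n ⊛_) (𝟘^suc 5)) (⊛-zeroʳ (approx (a m) n))

      sum-terms : ∀ n → sum (λ m → term n m (x m)) ≡ 𝟘 ⊕ term n i X₁ ⊕ term n j X₂ ⊕ term n p X₃ ⊕ term n q X₄
      sum-terms n = begin
        sum (λ m → term n m (x m))
          ≡⟨ sum-updateAt′ (term n) x₃ q X₄ (trans (cong (term n q) x₃q) (term-zero n q)) ⟩
        sum (λ m → term n m (x₃ m)) ⊕ term n q X₄
          ≡⟨ cong (_⊕ term n q X₄) (sum-updateAt′ (term n) x₂ p X₃ (trans (cong (term n p) x₂p) (term-zero n p))) ⟩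
        sum (λ m → term n m (x₂ m)) ⊕ term n p X₃ ⊕ term n q X₄
          ≡⟨ cong (λ s → s ⊕ term n p X₃ ⊕ term n q X₄) (sum-updateAt′ (term n) x₁ j X₂ (trans (cong (term n j) x₁j) (term-zero n j))) ⟩
        sum (λ m → term n m (x₁ m)) ⊕ term n j X₂ ⊕ term n p X₃ ⊕ term n q X₄
          ≡⟨ cong (λ s → s ⊕ term n j X₂ ⊕ term n p X₃ ⊕ term n q X₄) (sum-updateAt′ (term n) (const zero𝒪) i X₁ (term-zero n i)) ⟩
        sum (λ m → term n m zero𝒪) ⊕ term n i X₁ ⊕ term n j X₂ ⊕ term n p X₃ ⊕ term n q X₄
          ≡⟨ cong (λ s → s ⊕ term n i X₁ ⊕ term n j X₂ ⊕ term n p X₃ ⊕ term n q X₄)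
                  (trans (sum-cong-≗ (term-zero n)) (sum-replicate-zero 7)) ⟩
        𝟘 ⊕ term n i X₁ ⊕ term n j X₂ ⊕ term n p X₃ ⊕ term n q X₄
          ∎
        where
        open ≡-Reasoning
        x₃q : x₃ q ≡ zero𝒪
        x₃q = trans (updateAt-minimal q p x₂ (p≢q ∘ sym))
                    (trans (updateAt-minimal q j x₁ (j≢q ∘ sym)) (updateAt-minimal q i _ (i≢q ∘ sym)))
        x₂p : x₂ p ≡ zero𝒪
        x₂p = trans (updateAt-minimal p j x₁ (j≢p ∘ sym)) (updateAt-minimal p i _ (i≢p ∘ sym))
        x₁j : x₁ j ≡ zero𝒪
        x₁j = updateAt-minimal j i _ (i≢j ∘ sym)

      M₃ M₄ : ℕ
      M₃ = (toℕ k ℕ.+ 3) ℕ.+ Σr ℕ.* 6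
      M₄ = (toℕ k ℕ.+ 4) ℕ.+ Σr ℕ.* 6

      π^shift : ∀ s → π ^ ((toℕ k ℕ.+ s) ℕ.+ Σr ℕ.* 6) ≡ π ^ s ⊛ π ^ M
      π^shift s = trans (cong (π ^_) (shift (toℕ k) s (Σr ℕ.* 6))) (^-+ π s M)
        where
        shift : ∀ ℓ s m → (ℓ ℕ.+ s) ℕ.+ m ≡ s ℕ.+ (ℓ ℕ.+ m)
        shift = ℕ-Solver.solve-∀

      collect : ∀ n →
        𝟘 ⊕ π ^ M ⊛ (U n ⊛ roots n ^ 6) ⊕ π ^ M ⊛ (unitFactor c (y₂ n) ⊛ 𝟙 ^ 6)
          ⊕ π ^ M₃ ⊛ (unitFactor c₃ (y₃ n) ⊛ bit z ^ 6) ⊕ π ^ M₄ ⊛ (unitFactor c₄ (y₄ n) ⊛ bit t ^ 6)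
        ≡ π ^ M ⊛ (U n ⊛ roots n ^ 6 ⊖ S n)
      collect n = trans (cong₃ (λ o A B → 𝟘 ⊕ P ⊛ W ⊕ P ⊛ (u₂ ⊛ o) ⊕ A ⊕ B) (𝟙^ 6)
                               (cong₂ (λ Q b → Q ⊛ (u₃ ⊛ b)) (π^shift 3) (bit⁶ z))
                               (cong₂ (λ Q b → Q ⊛ (u₄ ⊛ b)) (π^shift 4) (bit⁶ t)))
                        (factor W u₂ u₃ u₄ (bit z) (bit t) (π ^ 3) (π ^ 4) P)
        where
        P W u₂ u₃ u₄ : Zα
        P = π ^ M
        W = U n ⊛ roots n ^ 6
        u₂ = unitFactor c (y₂ n)
        u₃ = unitFactor c₃ (y₃ n)
        u₄ = unitFactor c₄ (y₄ n)
        cong₃ : ∀ {A B C D : Set} (f : A → B → C → D) {a a′ b b′ c c′} →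
                a ≡ a′ → b ≡ b′ → c ≡ c′ → f a b c ≡ f a′ b′ c′
        cong₃ f refl refl refl = refl
        factor : ∀ W u₂ u₃ u₄ bz bt A B P →
          𝟘 ⊕ P ⊛ W ⊕ P ⊛ (u₂ ⊛ 𝟙) ⊕ (A ⊛ P) ⊛ (u₃ ⊛ bz) ⊕ (B ⊛ P) ⊛ (u₄ ⊛ bt)
            ≡ P ⊛ (W ⊖ - (u₂ ⊕ A ⊛ u₃ ⊛ bz ⊕ B ⊛ u₄ ⊛ bt))
        factor = solve 9 (λ W u₂ u₃ u₄ bz bt A B P →
          con (+ 0) :+ P :* W :+ P :* (u₂ :* con (+ 1)) :+ (A :* P) :* (u₃ :* bz) :+ (B :* P) :* (u₄ :* bt)
            := P :* (W :- (:- (u₂ :+ A :* u₃ :* bz :+ B :* u₄ :* bt)))) refl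

      term≡ : ∀ n m → term n m (x m) ≡ _*α_ F (approx (a m) n) (_^α_ F (approx (x m) n) 6)
      term≡ n m = trans (⊛≡*α (approx (a m) n) (approx (x m) n ^ 6)) (cong (_*α_ F (approx (a m) n)) (^≡^α (approx (x m) n) 6))

      solution : IsSolution F a x
      solution n = subst (λ s → Cong n s zeroα)
        (trans (sum-cong-≗ (term≡ n)) (sym (sumα≡sum (λ m → _*α_ F (approx (a m) n) (_^α_ F (approx (x m) n) 6)))))
        (≈⇒Cong (begin
        sum (λ m → term n m (x m))
          ≡⟨ sum-terms n ⟩
        𝟘 ⊕ term n i X₁ ⊕ term n j X₂ ⊕ term n p X₃ ⊕ term n q X₄
          ≈⟨ ⊕-cong (⊕-cong (⊕-cong (⊕-cong (≈-refl {x = 𝟘}) (term≈ L₁ e₁ (proj₂ E₁) n (roots n)))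
                                     (term≈ L₂ e₂ (proj₂ E₂) n 𝟙))
                            (term≈ L₃ e₃ (proj₂ E₃) n (bit z)))
                    (term≈ L₄ e₄ (proj₂ E₄) n (bit t)) ⟩
        𝟘 ⊕ π ^ M ⊛ (U n ⊛ roots n ^ 6) ⊕ π ^ M ⊛ (unitFactor c (y₂ n) ⊛ 𝟙 ^ 6)
          ⊕ π ^ M₃ ⊛ (unitFactor c₃ (y₃ n) ⊛ bit z ^ 6) ⊕ π ^ M₄ ⊛ (unitFactor c₄ (y₄ n) ⊛ bit t ^ 6)
          ≡⟨ collect n ⟩
        π ^ M ⊛ (U n ⊛ roots n ^ 6 ⊖ S n)
          ≈⟨ ∣⇒≈𝟘 (∣-⊛ˡ (π ^ M) (divides-difference (roots-solve n))) ⟩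
        𝟘 ∎))
        where open SetoidReasoning (≈-setoid n)

      x-j : x j ≡ X₂
      x-j = trans (updateAt-minimal j q x₃ j≢q) (trans (updateAt-minimal j p x₂ j≢p) (updateAt-updates j x₁))

      x-j-nonzero : Nonzero (x j)
      x-j-nonzero = subst Nonzero (sym x-j)
        (suc e₂ , λ π^e₂≡𝟘 →
          π^⊛unit≉𝟘 e₂ (unit (≈-reflexive (⊛-identityˡ 𝟙))) (Cong⇒≈ {x = π ^ e₂ ⊛ 𝟙} {𝟘} π^e₂≡𝟘))

opaque
  unfolding SexticForms.residueClaim? SexticForms.seedFacts?

  residueClaim-holds : ∀ F → SexticForms.ResidueClaim F
  residueClaim-holds Q2i   = toWitness {a? = SexticForms.residueClaim? Q2i} _
  residueClaim-holds Q2√-5 = toWitness {a? = SexticForms.residueClaim? Q2√-5} _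

  seedFacts-hold : ∀ F → SexticForms.SeedFacts F
  seedFacts-hold Q2i   = toWitness {a? = SexticForms.seedFacts? Q2i} _
  seedFacts-hold Q2√-5 = toWitness {a? = SexticForms.seedFacts? Q2√-5} _

lemma17 : (F : Field) (a : Fin 7 → 𝒪) (k : Fin 6) →
    (∀ i → ¬ IsZero (a i)) →
    (Σ (Fin 7) λ i → Σ (Fin 7) λ j → Σ Bool λ c →
    (i ≢ j) × LevelCoef F (a i) (toℕ k) c × LevelCoef F (a j) (toℕ k) c) →
    (Σ (Fin 7) λ i → AtLevel F (a i) (toℕ k + 3)) →
    (Σ (Fin 7) λ i → AtLevel F (a i) (toℕ k + 4)) →
    Σ (Fin 7 → 𝒪) λ x → IsSolution F a x × (Σ (Fin 7) λ i → Nonzero (x i))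
-- The hypothesis that no coefficient vanishes is not needed: the solution is supported on the
-- four indices whose coefficients have a prescribed level, hence are nonzero.
lemma17 F a k _ (i , j , c , i≢j , lc₁ , lc₂) (p , c₃ , lc₃) (q , c₄ , lc₄) = x , solution , j , x-j-nonzero
  where
  open SexticForms.Construction F (residueClaim-holds F) (seedFacts-hold F)
  open Assembly a k i j p q c c₃ c₄ i≢j lc₁ lc₂ lc₃ lc₄
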